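{- Let $n$ and $g$ be positive integers. If there exist a perpendicular array PA$_{2g}(2,n,n)$ and a large set with multiplicity LS$(3,4,n;g(n-1))$, then there exists a large set with multiplicity LS$(3,4,2n;g(n-1))$.
   Context: A Steiner system S$(t,k,n)$ is a pair $(Q,B)$ where $Q$ is an $n$-set and $B$ is a collection of $k$-subsets (blocks) of $Q$ such that every $t$-subset of $Q$ is contained in exactly one block. A large set with multiplicity $\mu$, LS$(t,k,n;\mu)$, is a family (the same system may occur more than once) of Steiner systems S$(t,k,n)$ on a common $n$-set $Q$ such that every $k$-subset of $Q$ is a block of exactly $\mu$ of the systems. A perpendicular array PA$_\lambda(k,\ell,n)$ is a $\lambda\binom{n}{k}\times \ell$ matrix with entries from an $n$-set such that each row has $\ell$ distinct entries and, in the submatrix formed by any $k$ columns, each $k$-subset of the $n$-set occurs (as the set of entries of a row) exactly $\lambda$ times. -}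

module Defs where

open import Data.Bool.Properties using () renaming (_≟_ to _≟ᵇ_)
open import Data.Fin using (Fin)
open import Data.Fin.Properties using (any?) renaming (_≟_ to _≟ᶠ_)
open import Data.Fin.Subset using (Subset; ∣_∣; _⊆_)
open import Data.Fin.Subset.Properties using (_∈?_)
open import Data.List using (List; []; length; filter; allFin)
open import Data.Nat using (ℕ; _*_)
open import Data.Nat.Combinatorics using (_C_)
open import Data.Product using (_×_; ∃!)
open import Data.Vec using (tabulate)
open import Data.Vec.Properties using (≡-dec)
open import Function.Definitions using (Injective)
open import Level using (0ℓ)
open import Relation.Binary.Definitions using (DecidableEquality)
open import Relation.Binary.PropositionalEquality using (_≡_; _≢_)
open import Relation.Nullary.Decidable using (does; _×-dec_)
open import Relation.Unary using (Pred; Decidable)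

_≟ˢ_ : ∀ {n} → DecidableEquality (Subset n)
_≟ˢ_ = ≡-dec _≟ᵇ_

-- The n-set of points is Fin n.  The set of blocks is given by its
-- (decidable) membership predicate, so no block is repeated.
record SteinerSystem (t k n : ℕ) : Set₁ where
  field
    Block      : Pred (Subset n) 0ℓ
    block?     : Decidable Block
    block-size : ∀ {b} → Block b → ∣ b ∣ ≡ k
    steiner    : ∀ (T : Subset n) → ∣ T ∣ ≡ t → ∃! _≡_ (λ b → Block b × T ⊆ b)

open SteinerSystem public using (Block; block?)

-- Positions in the list distinguish repeated systems.  A large set is
-- required to contain at least one system.  This is automatic when k ≤ n and
-- 0 < μ, but otherwise the empty list would be a large set even where no
-- Steiner system exists: for instance there is no S(3,4,3), while a 3-set has
-- no 4-subsets to cover.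
record LargeSet (t k n μ : ℕ) : Set₁ where
  field
    systems  : List (SteinerSystem t k n)
    nonempty : systems ≢ []
    covering : ∀ (K : Subset n) → ∣ K ∣ ≡ k →
               length (filter (λ 𝒮 → block? 𝒮 K) systems) ≡ μ

-- The image of the set of columns J under f.
entries : ∀ {ℓ n} → (Fin ℓ → Fin n) → Subset ℓ → Subset n
entries f J = tabulate λ y → does (any? λ c → (c ∈? J) ×-dec (f c ≟ᶠ y))

-- `matrix r c` is the entry in row r and column c.
record PerpendicularArray (lam k ℓ n : ℕ) : Set where
  field
    matrix       : Fin (lam * (n C k)) → Fin ℓ → Fin n
    row-distinct : ∀ r → Injective _≡_ _≡_ (matrix r)
    balanced     : ∀ (J : Subset ℓ) → ∣ J ∣ ≡ k →
                   ∀ (K : Subset n) → ∣ K ∣ ≡ k →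
                   length (filter (λ r → entries (matrix r) J ≟ˢ K)
                                  (allFin (lam * (n C k)))) ≡ lam

{-# OPTIONS --safe #-}

-- A 4-subset of the 2n points is a pair (p , q) of subsets of the n-set, one on
-- each copy; x′ is the point x of the second copy.
--
-- Each system of the given large set is doubled by taking its blocks on both
-- copies and, as mixed blocks, the pairs p, q of 2-sets with
-- colour p ⊙ colour q = s.  Here colour is the one-factorization coming from
-- the Steiner loop of one fixed system 𝒮₀, and ⊙ is a totally symmetric
-- quasigroup on its n - 1 colours, so each pair (p , q) occurs for exactly one
-- shift s.  There are g(n-1)(n-3) systems, and each shift is used g(n-3) times.
--
-- Each row π of the perpendicular array gives a system with the blocks
-- {x, y, z, π(w)′}, {π⁻¹(w), x′, y′, z′} for {x, y, z, w} ∈ 𝒮₀ and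
-- {x, y, π(x)′, π(y)′}.  Two columns of the array together contain every symbol
-- 2g(n-1) times, and as there are at least three columns each single one contains
-- it g(n-1) times; this counts the (3,1) and (1,3) blocks.  The (2,2) blocks occur
-- 2g times here and g(n-3) times in the first family.
--
-- For n ≤ 2 the 2n points have at most one 4-subset.
module Submission where

open import Defs
open import Data.Bool using (if_then_else_)
import Data.Empty as Empty
open import Data.Fin using (Fin; zero; suc; _≟_)
open import Data.Fin.Properties using (any?)
import Data.Fin.Properties as Fin
open import Data.Fin.Subset
  using (Subset; inside; outside; ∣_∣; _⊆_; _∈_; _∉_; _∪_; _∩_; _─_; ∁; ⁅_⁆; ⊤; ⊥; Nonempty)
open import Data.Fin.Subset.Properties
open import Data.List using (List; []; _∷_; length; filter; map; allFin; concat; replicate; zipWith)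
  renaming (_++_ to _++ˡ_)
open import Data.List.Properties
  using (length-++; length-replicate; length-tabulate; filter-++; map-tabulate; ++-conicalˡ)
open import Data.Nat using (ℕ; zero; suc; _+_; _*_; _∸_; _<_; _≤_; z≤n; s≤s)
import Data.Nat as ℕ
open import Data.Nat.Combinatorics using (_C_)
open import Data.Nat.ListAction using (sum)
open import Data.Nat.Properties hiding (_≟_; _≤?_)
open import Data.Nat.Tactic.RingSolver using (solve-∀)
open import Data.Product using (_×_; _,_; ∃; ∃₂; ∃!; proj₁; proj₂)
open import Data.Sum using (_⊎_; inj₁; inj₂; [_,_]′)
open import Data.Vec using (_∷_; []; _++_; take; drop; here; there)
open import Data.Vec.Properties using (lookup⇒[]=; []=⇒lookup; lookup∘tabulate; take++drop≡id)
open import Function using (_∘_; case_of_; flip; _⇔_; mk⇔; Equivalence)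
open import Function.Definitions using (Injective)
open import Level using (Level; 0ℓ)
open import Relation.Binary.Core using (REL; Rel)
import Relation.Binary.Definitions as B
open import Relation.Binary.PropositionalEquality
open import Relation.Nullary using (Dec; does; ¬_; ¬?; yes; no; contradiction)
open import Relation.Nullary.Decidable using (_×-dec_; _⊎-dec_; dec-true)
open import Relation.Unary using (Pred; Decidable)

open Equivalence using (to; from)

private variable
  ℓ m n : ℕ
  p q r : Subset n
  x y : Fin n
  α β γ ℓ₁ ℓ₂ : Level
  X : Set α
  Y : Set β
  Z : Set γ

-- Finite subsets and their images

⊆∧∣∣≥⇒≡ : p ⊆ q → ∣ q ∣ ≤ ∣ p ∣ → p ≡ q
⊆∧∣∣≥⇒≡ {p = p} {q} p⊆q ∣q∣≤∣p∣ = ⊆-antisym p⊆q q⊆p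
  where
  q⊆p : q ⊆ p
  q⊆p {x} x∈q with x ∈? p
  ... | yes x∈p = x∈p
  ... | no  x∉p = contradiction ∣q∣≤∣p∣ (<⇒≱ (p⊂q⇒∣p∣<∣q∣ (p⊆q , x , x∈q , x∉p)))

∪-least : p ⊆ r → q ⊆ r → p ∪ q ⊆ r
∪-least {p = p} {q = q} p⊆r q⊆r x∈ = [ p⊆r , q⊆r ]′ (x∈p∪q⁻ p q x∈)

⁅x⁆⊆ : x ∈ p → ⁅ x ⁆ ⊆ p
⁅x⁆⊆ {x = x} {p} x∈p y∈ = subst (_∈ p) (sym (x∈⁅y⁆⇒x≡y x y∈)) x∈p

∣p∣≡0⇒p≡⊥ : (p : Subset n) → ∣ p ∣ ≡ 0 → p ≡ ⊥
∣p∣≡0⇒p≡⊥ {n} p ∣p∣≡0 = sym (⊆∧∣∣≥⇒≡ ⊥⊆ (≤-reflexive (trans ∣p∣≡0 (sym (∣⊥∣≡0 n)))))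

∣∪∣+∣∩∣ : (p q : Subset n) → ∣ p ∪ q ∣ + ∣ p ∩ q ∣ ≡ ∣ p ∣ + ∣ q ∣
∣∪∣+∣∩∣ [] [] = refl
∣∪∣+∣∩∣ (inside  ∷ p) (inside  ∷ q) = cong suc (trans (+-suc _ _) (trans (cong suc (∣∪∣+∣∩∣ p q)) (sym (+-suc _ _))))
∣∪∣+∣∩∣ (inside  ∷ p) (outside ∷ q) = cong suc (∣∪∣+∣∩∣ p q)
∣∪∣+∣∩∣ (outside ∷ p) (inside  ∷ q) = trans (cong suc (∣∪∣+∣∩∣ p q)) (sym (+-suc _ _))
∣∪∣+∣∩∣ (outside ∷ p) (outside ∷ q) = ∣∪∣+∣∩∣ p q

∣∪∣≤ : (p q : Subset n) → ∣ p ∪ q ∣ ≤ ∣ p ∣ + ∣ q ∣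
∣∪∣≤ p q = ≤-trans (m≤m+n _ _) (≤-reflexive (∣∪∣+∣∩∣ p q))

∣∪∣-disjoint : (p q : Subset n) → (∀ {x} → x ∈ p → x ∉ q) → ∣ p ∪ q ∣ ≡ ∣ p ∣ + ∣ q ∣
∣∪∣-disjoint {n} p q p∌q = begin
  ∣ p ∪ q ∣             ≡⟨ +-identityʳ _ ⟨
  ∣ p ∪ q ∣ + 0         ≡⟨ cong (∣ p ∪ q ∣ +_) (trans (cong ∣_∣ (Empty-unique p∩q-empty)) (∣⊥∣≡0 n)) ⟨
  ∣ p ∪ q ∣ + ∣ p ∩ q ∣ ≡⟨ ∣∪∣+∣∩∣ p q ⟩
  ∣ p ∣ + ∣ q ∣         ∎
  where
  open ≡-Reasoning
  p∩q-empty : ¬ Nonempty (p ∩ q)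
  p∩q-empty (x , x∈) with x∈p∩q⁻ p q x∈
  ... | x∈p , x∈q = p∌q x∈p x∈q

x∈p─q⇒x∉q : (p q : Subset n) → x ∈ p ─ q → x ∉ q
x∈p─q⇒x∉q (_ ∷ p) (outside ∷ q) (there x∈) (there x∈q) = x∈p─q⇒x∉q p q x∈ x∈q
x∈p─q⇒x∉q (_ ∷ p) (inside  ∷ q) (there x∈) (there x∈q) = x∈p─q⇒x∉q p q x∈ x∈q

p∪[q─p]≡q : p ⊆ q → p ∪ (q ─ p) ≡ q
p∪[q─p]≡q {p = p} {q} p⊆q = ⊆-antisym (∪-least p⊆q (p─q⊆p q p)) q⊆
  where
  q⊆ : q ⊆ p ∪ (q ─ p)
  q⊆ {x} x∈q with x ∈? p
  ... | yes x∈p = x∈p∪q⁺ (inj₁ x∈p)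
  ... | no  x∉p = x∈p∪q⁺ (inj₂ (x∈p∧x∉q⇒x∈p─q x∈q x∉p))

∣p∣+∣q─p∣≡∣q∣ : p ⊆ q → ∣ p ∣ + ∣ q ─ p ∣ ≡ ∣ q ∣
∣p∣+∣q─p∣≡∣q∣ {p = p} {q} p⊆q =
  trans (sym (∣∪∣-disjoint p (q ─ p) (λ x∈p x∈ → x∈p─q⇒x∉q q p x∈ x∈p))) (cong ∣_∣ (p∪[q─p]≡q p⊆q))

∣q─p∣≡ : ∀ {k m} → p ⊆ q → ∣ p ∣ ≡ k → ∣ q ∣ ≡ k + m → ∣ q ─ p ∣ ≡ m
∣q─p∣≡ {q = q} {k} {m} p⊆q refl ∣q∣ = +-cancelˡ-≡ k _ m (trans (∣p∣+∣q─p∣≡∣q∣ {q = q} p⊆q) ∣q∣)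

∣p∣≡1+k⇒nonempty : ∀ {k} (p : Subset n) → ∣ p ∣ ≡ suc k → Nonempty p
∣p∣≡1+k⇒nonempty {n} p ∣p∣ with nonempty? p
... | yes ne = ne
... | no  e  = case trans (sym ∣p∣) (trans (cong ∣_∣ (Empty-unique e)) (∣⊥∣≡0 n)) of λ ()

⁅x⁆≡p : ∣ p ∣ ≡ 1 → x ∈ p → ⁅ x ⁆ ≡ p
⁅x⁆≡p {x = x} ∣p∣≡1 x∈p = ⊆∧∣∣≥⇒≡ (⁅x⁆⊆ x∈p) (≤-reflexive (trans ∣p∣≡1 (sym (∣⁅x⁆∣≡1 x))))

∣p∣≡1⇒singleton : (p : Subset n) → ∣ p ∣ ≡ 1 → ∃ λ x → p ≡ ⁅ x ⁆
∣p∣≡1⇒singleton p ∣p∣≡1 with ∣p∣≡1+k⇒nonempty p ∣p∣≡1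
... | x , x∈p = x , sym (⁅x⁆≡p ∣p∣≡1 x∈p)

⁅⁆-injective : ⁅ x ⁆ ≡ ⁅ y ⁆ → x ≡ y
⁅⁆-injective {x = x} {y} eq = x∈⁅y⁆⇒x≡y y (subst (x ∈_) eq (x∈⁅x⁆ x))

∣⁅x⁆∪p∣ : x ∉ p → ∣ ⁅ x ⁆ ∪ p ∣ ≡ suc ∣ p ∣
∣⁅x⁆∪p∣ {x = x} {p} x∉p = trans
  (∣∪∣-disjoint ⁅ x ⁆ p (λ y∈ y∈p → x∉p (subst (_∈ p) (x∈⁅y⁆⇒x≡y x y∈) y∈p)))
  (cong (_+ ∣ p ∣) (∣⁅x⁆∣≡1 x))

∣⁅x⁆∪⁅y⁆∣ : x ≢ y → ∣ ⁅ x ⁆ ∪ ⁅ y ⁆ ∣ ≡ 2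
∣⁅x⁆∪⁅y⁆∣ {y = y} x≢y = trans (∣⁅x⁆∪p∣ (x≢y⇒x∉⁅y⁆ x≢y)) (cong suc (∣⁅x⁆∣≡1 y))

⁅x⁆∪⁅y⁆≡p : ∣ p ∣ ≡ 2 → x ≢ y → x ∈ p → y ∈ p → ⁅ x ⁆ ∪ ⁅ y ⁆ ≡ p
⁅x⁆∪⁅y⁆≡p ∣p∣≡2 x≢y x∈p y∈p =
  ⊆∧∣∣≥⇒≡ (∪-least (⁅x⁆⊆ x∈p) (⁅x⁆⊆ y∈p)) (≤-reflexive (trans ∣p∣≡2 (sym (∣⁅x⁆∪⁅y⁆∣ x≢y))))

other : (p : Subset n) → ∣ p ∣ ≡ 2 → x ∈ p → ∃ λ y → x ≢ y × y ∈ p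
other {x = x} p ∣p∣≡2 x∈p with ∣p∣≡1+k⇒nonempty (p ─ ⁅ x ⁆) (∣q─p∣≡ {q = p} (⁅x⁆⊆ x∈p) (∣⁅x⁆∣≡1 x) ∣p∣≡2)
... | y , y∈ = y , (λ { refl → x∈p─q⇒x∉q p ⁅ x ⁆ y∈ (x∈⁅x⁆ x) }) , p─q⊆p p ⁅ x ⁆ y∈

two-elements : (p : Subset n) → ∣ p ∣ ≡ 2 → ∃₂ λ x y → x ≢ y × x ∈ p × y ∈ p
two-elements p ∣p∣≡2 with ∣p∣≡1+k⇒nonempty p ∣p∣≡2
... | x , x∈p with other p ∣p∣≡2 x∈p
...   | y , x≢y , y∈p = x , y , x≢y , x∈p , y∈p

∈entries⁺ : (f : Fin ℓ → Fin n) (J : Subset ℓ) → x ∈ J → f x ∈ entries f J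
∈entries⁺ {x = x} f J x∈J = lookup⇒[]= (f x) _
  (trans (lookup∘tabulate _ (f x)) (dec-true (any? λ c → (c ∈? J) ×-dec (f c ≟ f x)) (x , x∈J , refl)))

∈entries⁻ : (f : Fin ℓ → Fin n) (J : Subset ℓ) → y ∈ entries f J → ∃ λ x → x ∈ J × f x ≡ y
∈entries⁻ {y = y} f J y∈ with any? (λ c → (c ∈? J) ×-dec (f c ≟ y)) | trans (sym (lookup∘tabulate _ y)) ([]=⇒lookup y∈)
... | yes w | _ = w
... | no  _ | ()

entries-⊆ : (f : Fin ℓ → Fin n) {J K : Subset ℓ} → J ⊆ K → entries f J ⊆ entries f K
entries-⊆ f {J} {K} J⊆K y∈ with ∈entries⁻ f J y∈
... | x , x∈J , refl = ∈entries⁺ f K (J⊆K x∈J)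

entries-singleton : (f : Fin ℓ → Fin n) (x : Fin ℓ) → entries f ⁅ x ⁆ ≡ ⁅ f x ⁆
entries-singleton f x = ⊆-antisym ⊆ʳ (⁅x⁆⊆ (∈entries⁺ f ⁅ x ⁆ (x∈⁅x⁆ x)))
  where
  ⊆ʳ : entries f ⁅ x ⁆ ⊆ ⁅ f x ⁆
  ⊆ʳ y∈ with ∈entries⁻ f ⁅ x ⁆ y∈
  ... | z , z∈ , refl = subst (λ w → f z ∈ ⁅ f w ⁆) (x∈⁅y⁆⇒x≡y x z∈) (x∈⁅x⁆ (f z))

entries-inverse : (f : Fin ℓ → Fin n) (f⁻¹ : Fin n → Fin ℓ) → (∀ y → f (f⁻¹ y) ≡ y) →
                  (K : Subset n) → entries f (entries f⁻¹ K) ≡ K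
entries-inverse f f⁻¹ inv K = ⊆-antisym ⊆ʳ ⊆ˡ
  where
  ⊆ʳ : entries f (entries f⁻¹ K) ⊆ K
  ⊆ʳ y∈ with ∈entries⁻ f _ y∈
  ... | x , x∈ , refl with ∈entries⁻ f⁻¹ K x∈
  ... | z , z∈ , refl = subst (_∈ K) (sym (inv z)) z∈
  ⊆ˡ : K ⊆ entries f (entries f⁻¹ K)
  ⊆ˡ {y} y∈ = subst (_∈ entries f (entries f⁻¹ K)) (inv y) (∈entries⁺ f _ (∈entries⁺ f⁻¹ K y∈))

-- Induction along `J`: if the first point lies in `J`, injectivity keeps `f zero` out of the image
-- of the rest, so it adds exactly one element.
∣entries∣ : (f : Fin ℓ → Fin n) → Injective _≡_ _≡_ f → (J : Subset ℓ) → ∣ entries f J ∣ ≡ ∣ J ∣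
∣entries∣ {n = n} f f-inj [] = trans (cong ∣_∣ (Empty-unique λ (y , y∈) → case ∈entries⁻ f [] y∈ of λ { (_ , () , _) })) (∣⊥∣≡0 n)
∣entries∣ f f-inj (outside ∷ J) = trans (cong ∣_∣ (⊆-antisym ⊆ʳ ⊆ˡ)) (∣entries∣ (f ∘ suc) (Fin.suc-injective ∘ f-inj) J)
  where
  ⊆ʳ : entries f (outside ∷ J) ⊆ entries (f ∘ suc) J
  ⊆ʳ y∈ with ∈entries⁻ f (outside ∷ J) y∈
  ... | suc x , there x∈ , refl = ∈entries⁺ (f ∘ suc) J x∈
  ⊆ˡ : entries (f ∘ suc) J ⊆ entries f (outside ∷ J)
  ⊆ˡ y∈ with ∈entries⁻ (f ∘ suc) J y∈
  ... | x , x∈ , refl = ∈entries⁺ f (outside ∷ J) (there x∈)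
∣entries∣ f f-inj (inside ∷ J) = begin
  ∣ entries f (inside ∷ J) ∣            ≡⟨ cong ∣_∣ (⊆-antisym ⊆ʳ ⊆ˡ) ⟩
  ∣ ⁅ f zero ⁆ ∪ entries (f ∘ suc) J ∣  ≡⟨ ∣⁅x⁆∪p∣ f0∉ ⟩
  suc ∣ entries (f ∘ suc) J ∣           ≡⟨ cong suc (∣entries∣ (f ∘ suc) (Fin.suc-injective ∘ f-inj) J) ⟩
  suc ∣ J ∣                             ∎
  where
  open ≡-Reasoning
  f0∉ : f zero ∉ entries (f ∘ suc) J
  f0∉ f0∈ with ∈entries⁻ (f ∘ suc) J f0∈
  ... | x , _ , eq = case f-inj eq of λ ()
  ⊆ʳ : entries f (inside ∷ J) ⊆ ⁅ f zero ⁆ ∪ entries (f ∘ suc) J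
  ⊆ʳ y∈ with ∈entries⁻ f (inside ∷ J) y∈
  ... | zero  , _        , refl = x∈p∪q⁺ (inj₁ (x∈⁅x⁆ (f zero)))
  ... | suc x , there x∈ , refl = x∈p∪q⁺ (inj₂ (∈entries⁺ (f ∘ suc) J x∈))
  ⊆ˡ : ⁅ f zero ⁆ ∪ entries (f ∘ suc) J ⊆ entries f (inside ∷ J)
  ⊆ˡ = ∪-least (⁅x⁆⊆ (∈entries⁺ f (inside ∷ J) here)) ⊆ˡ′
    where
    ⊆ˡ′ : entries (f ∘ suc) J ⊆ entries f (inside ∷ J)
    ⊆ˡ′ y∈ with ∈entries⁻ (f ∘ suc) J y∈
    ... | x , x∈ , refl = ∈entries⁺ f (inside ∷ J) (there x∈)

-- The image of the full set has n elements, hence is the full set.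
injective⇒surjective : {f : Fin n → Fin n} → Injective _≡_ _≡_ f → ∀ y → ∃ λ x → f x ≡ y
injective⇒surjective {n} {f} f-inj y
  with ∈entries⁻ f ⊤ (subst (y ∈_) (sym (∣p∣≡n⇒p≡⊤ (trans (∣entries∣ f f-inj ⊤) (∣⊤∣≡n n)))) ∈⊤)
... | x , _ , fx≡y = x , fx≡y

-- Doubling a quadruple system

take-⊆ : ∀ m {p q : Subset (m + n)} → p ⊆ q → take m p ⊆ take m q
take-⊆ (suc m) {_ ∷ p} {_ ∷ q} p⊆q here with here ← p⊆q here = here
take-⊆ (suc m) {_ ∷ p} {_ ∷ q} p⊆q (there x∈) = there (take-⊆ m (drop-∷-⊆ p⊆q) x∈)

drop-⊆ : ∀ m {p q : Subset (m + n)} → p ⊆ q → drop m p ⊆ drop m q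
drop-⊆ zero    p⊆q = p⊆q
drop-⊆ (suc m) {_ ∷ p} {_ ∷ q} p⊆q = drop-⊆ m (drop-∷-⊆ p⊆q)

⊆-++ : ∀ m {r : Subset (m + n)} {p q} → take m r ⊆ p → drop m r ⊆ q → r ⊆ p ++ q
⊆-++ zero    {p = []} r⊆p r⊆q = r⊆q
⊆-++ (suc m) {_ ∷ r} {_ ∷ p} r⊆p r⊆q here with here ← r⊆p here = here
⊆-++ (suc m) {_ ∷ r} {_ ∷ p} r⊆p r⊆q (there x∈) = there (⊆-++ m (drop-∷-⊆ r⊆p) r⊆q x∈)

∣take∣+∣drop∣ : ∀ m (p : Subset (m + n)) → ∣ take m p ∣ + ∣ drop m p ∣ ≡ ∣ p ∣
∣take∣+∣drop∣ zero    p             = refl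
∣take∣+∣drop∣ (suc m) (inside  ∷ p) = cong suc (∣take∣+∣drop∣ m p)
∣take∣+∣drop∣ (suc m) (outside ∷ p) = ∣take∣+∣drop∣ m p

take-++ : (p : Subset m) (q : Subset n) → take m (p ++ q) ≡ p
take-++ []      q = refl
take-++ (x ∷ p) q = cong (x ∷_) (take-++ p q)

drop-++ : (p : Subset m) (q : Subset n) → drop m (p ++ q) ≡ q
drop-++ []      q = refl
drop-++ (x ∷ p) q = drop-++ p q

SubsetRel : ℕ → Set₁
SubsetRel n = Rel (Subset n) 0ℓ

∃!₂ : SubsetRel n → Set
∃!₂ {n} P = ∃! {A = Subset n × Subset n} _≡_ λ (p , q) → P p q

Pairs : SubsetRel n → SubsetRel n
Pairs R p q = ∣ p ∣ ≡ 2 × ∣ q ∣ ≡ 2 × R p q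

-- R gives the blocks with two points on each copy, A those with more points on
-- the first copy than on the second.
record Half (R A : SubsetRel n) : Set where
  field
    R?      : B.Decidable R
    A?      : B.Decidable A
    A-size  : ∀ {p q} → A p q → ∣ p ∣ + ∣ q ∣ ≡ 4
    A-thin  : ∀ {p q} → A p q → ∣ q ∣ ≤ 1
    cover₃  : ∀ {T : Subset n} → ∣ T ∣ ≡ 3 → ∃!₂ λ p q → A p q × T ⊆ p
    cover₂₁ : ∀ {T U : Subset n} → ∣ T ∣ ≡ 2 → ∣ U ∣ ≡ 1 →
              ∃!₂ λ p q → (Pairs R p q ⊎ A p q) × T ⊆ p × U ⊆ q

-- `A′` takes the heavier side first, so that exchanging the two copies turns `Split R A A′` into
-- `Split (flip R) A′ A`.
Split : (R A A′ : SubsetRel n) → SubsetRel n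
Split R A A′ p q = Pairs R p q ⊎ A p q ⊎ A′ q p

Split-swap : (R A A′ : SubsetRel n) → Split R A A′ p q → Split (flip R) A′ A q p
Split-swap _ _ _ (inj₁ (∣p∣ , ∣q∣ , Rpq)) = inj₁ (∣q∣ , ∣p∣ , Rpq)
Split-swap _ _ _ (inj₂ (inj₁ Apq))        = inj₂ (inj₂ Apq)
Split-swap _ _ _ (inj₂ (inj₂ A′qp))       = inj₂ (inj₁ A′qp)

sum≡3 : ∀ {a b} → a + b ≡ 3 → 2 ≤ a → (a ≡ 2 × b ≡ 1) ⊎ (a ≡ 3 × b ≡ 0)
sum≡3 {2} refl _ = inj₁ (refl , refl)
sum≡3 {3} refl _ = inj₂ (refl , refl)
sum≡3 {1} _ (s≤s ())

-- The triple is of type (2,1) or (3,0), the two cases covered by `H`. Blocks coming from `A′` have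
-- at most one point on the first copy, by `A-thin`, so none of them can contain it a second time.
cover-heavy : ∀ {R A A′ : SubsetRel n} → Half R A → Half (flip R) A′ →
              ∀ {T U : Subset n} → ∣ T ∣ + ∣ U ∣ ≡ 3 → 2 ≤ ∣ T ∣ →
              ∃!₂ λ p q → Split R A A′ p q × T ⊆ p × U ⊆ q
cover-heavy {n} {R} {A} {A′} H H′ {T} {U} sum 2≤ with sum≡3 sum 2≤
... | inj₁ (∣T∣ , ∣U∣) with Half.cover₂₁ H ∣T∣ ∣U∣
...   | (p , q) , (D , T⊆p , U⊆q) , unique = (p , q) , (embed D , T⊆p , U⊆q) , unique′
  where
  embed : Pairs R p q ⊎ A p q → Split R A A′ p q
  embed (inj₁ P) = inj₁ P
  embed (inj₂ a) = inj₂ (inj₁ a)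
  unique′ : ∀ {pq} → Split R A A′ (proj₁ pq) (proj₂ pq) × T ⊆ proj₁ pq × U ⊆ proj₂ pq → (p , q) ≡ pq
  unique′ (inj₁ P , sub)        = unique (inj₁ P , sub)
  unique′ (inj₂ (inj₁ a) , sub) = unique (inj₂ a , sub)
  unique′ (inj₂ (inj₂ a′) , T⊆ , _) =
    contradiction (≤-trans (≤-reflexive (sym ∣T∣)) (≤-trans (p⊆q⇒∣p∣≤∣q∣ T⊆) (Half.A-thin H′ a′))) (λ { (s≤s ()) })
cover-heavy {n} {R} {A} {A′} H H′ {T} {U} sum 2≤ | inj₂ (∣T∣ , ∣U∣) with Half.cover₃ H ∣T∣
...   | (p , q) , (a , T⊆p) , unique = (p , q) , (inj₂ (inj₁ a) , T⊆p , U⊆ q) , unique′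
  where
  U⊆ : ∀ q → U ⊆ q
  U⊆ q = subst (_⊆ q) (sym (∣p∣≡0⇒p≡⊥ U ∣U∣)) ⊥⊆
  unique′ : ∀ {pq} → Split R A A′ (proj₁ pq) (proj₂ pq) × T ⊆ proj₁ pq × U ⊆ proj₂ pq → (p , q) ≡ pq
  unique′ (inj₁ (∣p∣ , _) , T⊆ , _) =
    contradiction (subst₂ _≤_ ∣T∣ ∣p∣ (p⊆q⇒∣p∣≤∣q∣ T⊆)) (λ { (s≤s (s≤s ())) })
  unique′ (inj₂ (inj₁ a) , T⊆ , _) = unique (a , T⊆)
  unique′ (inj₂ (inj₂ a′) , T⊆ , _) =
    contradiction (≤-trans (≤-reflexive (sym ∣T∣)) (≤-trans (p⊆q⇒∣p∣≤∣q∣ T⊆) (Half.A-thin H′ a′))) (λ { (s≤s ()) })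

cover-any : ∀ {R A A′ : SubsetRel n} → Half R A → Half (flip R) A′ →
            ∀ {T U : Subset n} → ∣ T ∣ + ∣ U ∣ ≡ 3 →
            ∃!₂ λ p q → Split R A A′ p q × T ⊆ p × U ⊆ q
cover-any {n} {R} {A} {A′} H H′ {T} {U} sum with 2 ℕ.≤? ∣ T ∣
... | yes 2≤ = cover-heavy H H′ sum 2≤
-- With at most one of the three points on the first copy, at least two lie on the second, so the
-- heavy case applies after exchanging the copies.
... | no  2≰ with cover-heavy H′ H (trans (+-comm ∣ U ∣ _) sum)
                   (+-cancelˡ-≤ 1 _ _ (≤-trans (≤-reflexive (sym sum)) (+-monoˡ-≤ ∣ U ∣ (≤-pred (≰⇒> 2≰)))))
...   | (q , p) , (D , U⊆q , T⊆p) , unique =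
  (p , q) , (Split-swap (flip R) A′ A D , T⊆p , U⊆q) ,
  λ (D′ , T⊆ , U⊆) → case unique (Split-swap R A A′ D′ , U⊆ , T⊆) of λ { refl → refl }

doubled : {R A A′ : SubsetRel n} → Half R A → Half (flip R) A′ → SteinerSystem 3 4 (n + n)
doubled {n} {R} {A} {A′} H H′ = record
  { Block      = λ b → Split R A A′ (take n b) (drop n b)
  ; block?     = λ b → let p = take n b; q = drop n b in
                 ((∣ p ∣ ℕ.≟ 2) ×-dec (∣ q ∣ ℕ.≟ 2) ×-dec Half.R? H p q) ⊎-dec Half.A? H p q ⊎-dec Half.A? H′ q p
  ; block-size = λ {b} D → trans (sym (∣take∣+∣drop∣ n b)) (size D)
  ; steiner    = steiner
  }
  where
  size : Split R A A′ p q → ∣ p ∣ + ∣ q ∣ ≡ 4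
  size (inj₁ (∣p∣ , ∣q∣ , _)) = cong₂ _+_ ∣p∣ ∣q∣
  size (inj₂ (inj₁ a))        = Half.A-size H a
  size {p} {q} (inj₂ (inj₂ a′)) = trans (+-comm ∣ p ∣ _) (Half.A-size H′ a′)

  steiner : ∀ T → ∣ T ∣ ≡ 3 → ∃! _≡_ λ b → Split R A A′ (take n b) (drop n b) × T ⊆ b
  steiner T ∣T∣ with cover-any H H′ {take n T} {drop n T} (trans (∣take∣+∣drop∣ n T) ∣T∣)
  ... | (p , q) , (D , T⊆p , T⊆q) , unique =
    p ++ q ,
    (subst₂ (Split R A A′) (sym (take-++ p q)) (sym (drop-++ p q)) D , ⊆-++ n T⊆p T⊆q) ,
    λ {b} (D′ , T⊆b) → case unique (D′ , take-⊆ n T⊆b , drop-⊆ n T⊆b) of λ { refl → take++drop≡id n b }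

-- Completing triples to blocks

module _ {n} (𝒮 : SteinerSystem 3 4 n) where
  open SteinerSystem 𝒮 using (block-size; steiner)

  -- The fourth point of the block through `T`. It is kept as a 1-subset so that `entries` can
  -- transport it along a permutation.
  extension : ∀ T → ∣ T ∣ ≡ 3 →
              ∃ λ U → ∣ U ∣ ≡ 1 × Block 𝒮 (T ∪ U) × (∀ {V} → ∣ V ∣ ≡ 1 → Block 𝒮 (T ∪ V) → U ≡ V)
  extension T ∣T∣ with steiner T ∣T∣
  ... | b , (Bb , T⊆b) , unique = b ─ T , ∣U∣ , subst (Block 𝒮) (sym (p∪[q─p]≡q T⊆b)) Bb , unique′
    where
    ∣U∣ : ∣ b ─ T ∣ ≡ 1
    ∣U∣ = ∣q─p∣≡ {q = b} T⊆b ∣T∣ (block-size Bb)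
    unique′ : ∀ {V} → ∣ V ∣ ≡ 1 → Block 𝒮 (T ∪ V) → b ─ T ≡ V
    unique′ {V} ∣V∣ BTV with unique (BTV , p⊆p∪q V)
    ... | refl = ⊆∧∣∣≥⇒≡ U⊆V (≤-reflexive (trans ∣V∣ (sym ∣U∣)))
      where
      U⊆V : (T ∪ V) ─ T ⊆ V
      U⊆V x∈ with x∈p∪q⁻ T V (p─q⊆p _ T x∈)
      ... | inj₁ x∈T = contradiction x∈T (x∈p─q⇒x∉q _ T x∈)
      ... | inj₂ x∈V = x∈V

  ¬block-⊆ : ∀ {p q} → ∣ p ∣ ≡ 3 → q ⊆ p → ¬ Block 𝒮 (p ∪ q)
  ¬block-⊆ {p} {q} ∣p∣ q⊆p B =
    case trans (sym (block-size B)) (trans (cong ∣_∣ (⊆-antisym (∪-least ⊆-refl q⊆p) (p⊆p∪q q))) ∣p∣) of λ ()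

  -- The block `p ∪ u` contains the triple `T ∪ u`, so `p` can only be `T` together with the fourth
  -- point of the block through that triple. This covers the (2,1) triples that lie in a twisted
  -- block.
  replace : ∀ {T u : Subset n} → ∣ T ∣ ≡ 2 → ∣ u ∣ ≡ 1 → ∣ T ∪ u ∣ ≡ 3 →
            ∃! _≡_ λ p → (∣ p ∣ ≡ 3 × Block 𝒮 (p ∪ u)) × T ⊆ p
  replace {T} {u} ∣T∣ ∣u∣ ∣T∪u∣ with extension (T ∪ u) ∣T∪u∣
  ... | U , ∣U∣ , B , unique = T ∪ U , ((∣T∪U∣ , B′) , p⊆p∪q U) , unique′
    where
    swap : ∀ V → (T ∪ u) ∪ V ≡ (T ∪ V) ∪ u
    swap V = trans (∪-assoc T u V) (trans (cong (T ∪_) (∪-comm u V)) (sym (∪-assoc T V u)))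
    B′ : Block 𝒮 ((T ∪ U) ∪ u)
    B′ = subst (Block 𝒮) (swap U) B
    -- At least 3, because adding the single point of `u` yields a block, which has four points.
    ∣T∪U∣ : ∣ T ∪ U ∣ ≡ 3
    ∣T∪U∣ = ≤-antisym (≤-trans (∣∪∣≤ T U) (≤-reflexive (cong₂ _+_ ∣T∣ ∣U∣)))
      (+-cancelʳ-≤ 1 3 _ (≤-trans (≤-reflexive (sym (block-size B′)))
                           (≤-trans (∣∪∣≤ (T ∪ U) u) (≤-reflexive (cong (∣ T ∪ U ∣ +_) ∣u∣)))))
    unique′ : ∀ {p} → (∣ p ∣ ≡ 3 × Block 𝒮 (p ∪ u)) × T ⊆ p → T ∪ U ≡ p
    unique′ {p} ((∣p∣ , Bp) , T⊆p) =
      trans (cong (T ∪_) (unique (∣q─p∣≡ {q = p} T⊆p ∣T∣ ∣p∣) (subst (Block 𝒮) eq Bp))) (p∪[q─p]≡q T⊆p)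
      where
      eq : p ∪ u ≡ (T ∪ u) ∪ (p ─ T)
      eq = trans (cong (_∪ u) (sym (p∪[q─p]≡q T⊆p))) (sym (swap (p ─ T)))

-- Pure and twisted halves

Perfect : SubsetRel n → Set
Perfect R = ∀ T U → ∣ T ∣ ≡ 2 → ∣ U ∣ ≡ 1 → ∃! _≡_ λ q → (∣ q ∣ ≡ 2 × R T q) × U ⊆ q

Pure : SteinerSystem 3 4 n → SubsetRel n
Pure 𝒮 p q = Block 𝒮 p × ∣ q ∣ ≡ 0

-- Pure blocks have no point on the other copy, so a (2,1) triple must be covered by a mixed pair.
-- `Perfect R` provides this: for each pair `T`, the 2-sets related to `T` form a one-factor on the
-- other copy.
half-pure : (𝒮 : SteinerSystem 3 4 n) {R : SubsetRel n} → B.Decidable R → Perfect R → Half R (Pure 𝒮)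
half-pure {n} 𝒮 {R} R? perfect = record
  { R?      = R?
  ; A?      = λ p q → block? 𝒮 p ×-dec (∣ q ∣ ℕ.≟ 0)
  ; A-size  = λ (B , ∣q∣) → cong₂ _+_ (block-size B) ∣q∣
  ; A-thin  = λ (_ , ∣q∣) → ≤-trans (≤-reflexive ∣q∣) z≤n
  ; cover₃  = cover₃
  ; cover₂₁ = cover₂₁
  }
  where
  open SteinerSystem 𝒮 using (block-size; steiner)
  cover₃ : ∀ {T : Subset n} → ∣ T ∣ ≡ 3 → ∃!₂ λ p q → Pure 𝒮 p q × T ⊆ p
  cover₃ ∣T∣ with steiner _ ∣T∣
  ... | b , (B , T⊆b) , unique =
    (b , ⊥) , ((B , ∣⊥∣≡0 n) , T⊆b) ,
    λ { ((B′ , ∣q∣) , T⊆p) → cong₂ _,_ (unique (B′ , T⊆p)) (sym (∣p∣≡0⇒p≡⊥ _ ∣q∣)) }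
  cover₂₁ : ∀ {T U : Subset n} → ∣ T ∣ ≡ 2 → ∣ U ∣ ≡ 1 →
            ∃!₂ λ p q → (Pairs R p q ⊎ Pure 𝒮 p q) × T ⊆ p × U ⊆ q
  cover₂₁ {T} {U} ∣T∣ ∣U∣ with perfect T U ∣T∣ ∣U∣
  ... | q , ((∣q∣ , RTq) , U⊆q) , unique = (T , q) , (inj₁ (∣T∣ , ∣q∣ , RTq) , ⊆-refl , U⊆q) , unique′
    where
    unique′ : ∀ {pq} → (Pairs R (proj₁ pq) (proj₂ pq) ⊎ Pure 𝒮 (proj₁ pq) (proj₂ pq)) ×
              T ⊆ proj₁ pq × U ⊆ proj₂ pq → (T , q) ≡ pq
    unique′ (inj₁ (∣p∣ , ∣q∣ , Rpq) , T⊆p , U⊆q)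
      with ⊆∧∣∣≥⇒≡ T⊆p (≤-reflexive (trans ∣p∣ (sym ∣T∣)))
    ... | refl = cong (T ,_) (unique ((∣q∣ , Rpq) , U⊆q))
    unique′ (inj₂ (_ , ∣q∣) , _ , U⊆q) = contradiction (subst₂ _≤_ ∣U∣ ∣q∣ (p⊆q⇒∣p∣≤∣q∣ U⊆q)) (λ ())

-- For `q` = {π(w)} the union is `p` with w added, so these are the blocks {x, y, z, π(w)′}. Since
-- blocks have four points, w lies outside `p`.
Twisted : SteinerSystem 3 4 n → (Fin n → Fin n) → SubsetRel n
Twisted 𝒮 π⁻¹ p q = (∣ p ∣ ≡ 3 × Block 𝒮 (p ∪ entries π⁻¹ q)) × ∣ q ∣ ≡ 1

-- A (2,1) triple is sorted by its single point pulled back along π: if that lies in `T`, the triple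
-- is in the pair (T, π(T)), otherwise in a twisted block. `R` is any relation equivalent to "π maps
-- p onto q", so that the lemma also serves the converse relation with π⁻¹.
half-twisted : (𝒮 : SteinerSystem 3 4 n) {π π⁻¹ : Fin n → Fin n} →
               (∀ y → π (π⁻¹ y) ≡ y) → (∀ x → π⁻¹ (π x) ≡ x) →
               {R : SubsetRel n} → B.Decidable R →
               (∀ p q → R p q → entries π p ≡ q) → (∀ p q → entries π p ≡ q → R p q) →
               Half R (Twisted 𝒮 π⁻¹)
half-twisted {n} 𝒮 {π} {π⁻¹} invʳ invˡ {R} R? R⇒ ⇒R = record
  { R?      = R?
  ; A?      = λ p q → ((∣ p ∣ ℕ.≟ 3) ×-dec block? 𝒮 (p ∪ entries π⁻¹ q)) ×-dec (∣ q ∣ ℕ.≟ 1)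
  ; A-size  = λ ((∣p∣ , _) , ∣q∣) → cong₂ _+_ ∣p∣ ∣q∣
  ; A-thin  = λ (_ , ∣q∣) → ≤-reflexive ∣q∣
  ; cover₃  = cover₃
  ; cover₂₁ = cover₂₁
  }
  where
  ∣π∣ : ∀ J → ∣ entries π J ∣ ≡ ∣ J ∣
  ∣π∣ = ∣entries∣ π λ eq → trans (sym (invˡ _)) (trans (cong π⁻¹ eq) (invˡ _))
  ∣π⁻¹∣ : ∀ J → ∣ entries π⁻¹ J ∣ ≡ ∣ J ∣
  ∣π⁻¹∣ = ∣entries∣ π⁻¹ λ eq → trans (sym (invʳ _)) (trans (cong π eq) (invʳ _))
  cover₃ : ∀ {T : Subset n} → ∣ T ∣ ≡ 3 → ∃!₂ λ p q → Twisted 𝒮 π⁻¹ p q × T ⊆ p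
  cover₃ {T} ∣T∣ with extension 𝒮 T ∣T∣
  ... | U , ∣U∣ , B , unique =
    (T , entries π U) ,
    (((∣T∣ , subst (λ V → Block 𝒮 (T ∪ V)) (sym (entries-inverse π⁻¹ π invˡ U)) B) , trans (∣π∣ U) ∣U∣) , ⊆-refl) ,
    unique′
    where
    unique′ : ∀ {pq} → Twisted 𝒮 π⁻¹ (proj₁ pq) (proj₂ pq) × T ⊆ proj₁ pq → (T , entries π U) ≡ pq
    unique′ {p , q} (((∣p∣ , B′) , ∣q∣) , T⊆p) with ⊆∧∣∣≥⇒≡ T⊆p (≤-reflexive (trans ∣p∣ (sym ∣T∣)))
    ... | refl = cong (T ,_) (trans (cong (entries π) (unique (trans (∣π⁻¹∣ q) ∣q∣) B′)) (entries-inverse π π⁻¹ invʳ q))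
  cover₂₁ : ∀ {T U : Subset n} → ∣ T ∣ ≡ 2 → ∣ U ∣ ≡ 1 →
            ∃!₂ λ p q → (Pairs R p q ⊎ Twisted 𝒮 π⁻¹ p q) × T ⊆ p × U ⊆ q
  cover₂₁ {T} {U} ∣T∣ ∣U∣ with entries π⁻¹ U ⊆? T
  ... | yes u⊆T = (T , entries π T) , (inj₁ (∣T∣ , trans (∣π∣ T) ∣T∣ , ⇒R T _ refl) , ⊆-refl , U⊆πT) , unique′
    where
    U⊆πT : U ⊆ entries π T
    U⊆πT x∈U = entries-⊆ π u⊆T (subst (_ ∈_) (sym (entries-inverse π π⁻¹ invʳ U)) x∈U)
    unique′ : ∀ {pq} → (Pairs R (proj₁ pq) (proj₂ pq) ⊎ Twisted 𝒮 π⁻¹ (proj₁ pq) (proj₂ pq)) ×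
              T ⊆ proj₁ pq × U ⊆ proj₂ pq → (T , entries π T) ≡ pq
    unique′ (inj₁ (∣p∣ , _ , Rpq) , T⊆p , _)
      with ⊆∧∣∣≥⇒≡ T⊆p (≤-reflexive (trans ∣p∣ (sym ∣T∣)))
    ... | refl = cong (T ,_) (R⇒ _ _ Rpq)
    unique′ (inj₂ ((∣p∣ , B) , ∣q∣) , T⊆p , U⊆q)
      with ⊆∧∣∣≥⇒≡ U⊆q (≤-reflexive (trans ∣q∣ (sym ∣U∣)))
    -- The pulled back point would already lie in `p`, leaving the block with only three points.
    ... | refl = contradiction B (¬block-⊆ 𝒮 ∣p∣ (T⊆p ∘ u⊆T))
  ... | no u⊈T with replace 𝒮 ∣T∣ (trans (∣π⁻¹∣ U) ∣U∣) ∣T∪u∣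
    where
    -- `entries π⁻¹ U` has a single point, so not being contained in `T` means being disjoint from
    -- it.
    u∉T : ∀ {x} → x ∈ T → x ∉ entries π⁻¹ U
    u∉T x∈T x∈u = u⊈T λ y∈u →
      ⁅x⁆⊆ x∈T (subst (_ ∈_) (sym (⁅x⁆≡p (trans (∣π⁻¹∣ U) ∣U∣) x∈u)) y∈u)
    ∣T∪u∣ : ∣ T ∪ entries π⁻¹ U ∣ ≡ 3
    ∣T∪u∣ = trans (∣∪∣-disjoint T _ u∉T) (cong₂ _+_ ∣T∣ (trans (∣π⁻¹∣ U) ∣U∣))
  ...   | p , ((∣p∣ , B) , T⊆p) , unique = (p , U) , (inj₂ ((∣p∣ , B) , ∣U∣) , T⊆p , ⊆-refl) , unique′
    where
    unique′ : ∀ {pq} → (Pairs R (proj₁ pq) (proj₂ pq) ⊎ Twisted 𝒮 π⁻¹ (proj₁ pq) (proj₂ pq)) ×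
              T ⊆ proj₁ pq × U ⊆ proj₂ pq → (p , U) ≡ pq
    unique′ {_ , q} (inj₁ (∣p∣ , _ , Rpq) , T⊆p , U⊆q)
      with ⊆∧∣∣≥⇒≡ T⊆p (≤-reflexive (trans ∣p∣ (sym ∣T∣))) | R⇒ _ _ Rpq
    ... | refl | refl = contradiction (λ {x} → u⊆T {x}) u⊈T
      where
      u⊆T : entries π⁻¹ U ⊆ T
      u⊆T x∈ = subst (_ ∈_) (entries-inverse π⁻¹ π invˡ T) (entries-⊆ π⁻¹ U⊆q x∈)
    unique′ (inj₂ ((∣p∣ , B) , ∣q∣) , T⊆p , U⊆q)
      with ⊆∧∣∣≥⇒≡ U⊆q (≤-reflexive (trans ∣q∣ (sym ∣U∣)))
    ... | refl = cong (_, U) (unique ((∣p∣ , B) , T⊆p))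

-- The one-factorization of a quadruple system

module Loop {n} (𝒮 : SteinerSystem 3 4 n) (∞ : Fin n) where
  open SteinerSystem 𝒮 using (block-size; steiner)

  -- The graph of the Steiner loop with identity ∞.  It is invariant under all
  -- permutations of (a , b , c), so the loop laws follow from its functionality.
  data Line (a b c : Fin n) : Set where
    unitˡ : a ≡ ∞ → b ≡ c → Line a b c
    unitʳ : b ≡ ∞ → a ≡ c → Line a b c
    equal : c ≡ ∞ → a ≡ b → Line a b c
    block : a ≢ ∞ → b ≢ ∞ → c ≢ ∞ → a ≢ b → a ≢ c → b ≢ c →
            ∀ {β} → Block 𝒮 β → ∞ ∈ β → a ∈ β → b ∈ β → c ∈ β → Line a b c

  swapˡ : ∀ {a b c} → Line a b c → Line b a c
  swapˡ (unitˡ a≡∞ b≡c) = unitʳ a≡∞ b≡c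
  swapˡ (unitʳ b≡∞ a≡c) = unitˡ b≡∞ a≡c
  swapˡ (equal c≡∞ a≡b) = equal c≡∞ (sym a≡b)
  swapˡ (block a b c a≢b a≢c b≢c β ∞∈ a∈ b∈ c∈) = block b a c (a≢b ∘ sym) b≢c a≢c β ∞∈ b∈ a∈ c∈

  swapʳ : ∀ {a b c} → Line a b c → Line a c b
  swapʳ (unitˡ a≡∞ b≡c) = unitˡ a≡∞ (sym b≡c)
  swapʳ (unitʳ b≡∞ a≡c) = equal b≡∞ a≡c
  swapʳ (equal c≡∞ a≡b) = unitʳ c≡∞ a≡b
  swapʳ (block a b c a≢b a≢c b≢c β ∞∈ a∈ b∈ c∈) = block a c b a≢c a≢b (b≢c ∘ sym) β ∞∈ a∈ c∈ b∈

  ∞ab : Fin n → Fin n → Subset n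
  ∞ab a b = ⁅ ∞ ⁆ ∪ (⁅ a ⁆ ∪ ⁅ b ⁆)

  ∣∞ab∣ : ∀ {a b} → a ≢ ∞ → b ≢ ∞ → a ≢ b → ∣ ∞ab a b ∣ ≡ 3
  ∣∞ab∣ {a} {b} a≢∞ b≢∞ a≢b = trans (∣⁅x⁆∪p∣ ∞∉) (cong suc (∣⁅x⁆∪⁅y⁆∣ a≢b))
    where
    ∞∉ : ∞ ∉ ⁅ a ⁆ ∪ ⁅ b ⁆
    ∞∉ ∞∈ = [ a≢∞ ∘ sym ∘ x∈⁅y⁆⇒x≡y a , b≢∞ ∘ sym ∘ x∈⁅y⁆⇒x≡y b ]′ (x∈p∪q⁻ ⁅ a ⁆ ⁅ b ⁆ ∞∈)

  ∞ab⊆ : ∀ {a b β} → ∞ ∈ β → a ∈ β → b ∈ β → ∞ab a b ⊆ β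
  ∞ab⊆ ∞∈ a∈ b∈ = ∪-least (⁅x⁆⊆ ∞∈) (∪-least (⁅x⁆⊆ a∈) (⁅x⁆⊆ b∈))

  -- Two lines of kind `block` share the triple ∞, a, b and therefore their block, whose one
  -- remaining point is both c and d. Every other combination is settled by the equations, or
  -- contradicts the distinctness required by `block`.
  line-unique : ∀ {a b c d} → Line a b c → Line a b d → c ≡ d
  line-unique (unitˡ refl refl) (unitˡ _ refl)    = refl
  line-unique (unitˡ refl refl) (unitʳ refl refl) = refl
  line-unique (unitˡ refl refl) (equal refl refl) = refl
  line-unique (unitˡ refl refl) (block a _ _ _ _ _ _ _ _ _ _) = contradiction refl a
  line-unique (unitʳ refl refl) (unitˡ refl refl) = refl
  line-unique (unitʳ refl refl) (unitʳ _ refl)    = refl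
  line-unique (unitʳ refl refl) (equal refl refl) = refl
  line-unique (unitʳ refl refl) (block _ b _ _ _ _ _ _ _ _ _) = contradiction refl b
  line-unique (equal refl refl) (unitˡ refl refl) = refl
  line-unique (equal refl refl) (unitʳ refl refl) = refl
  line-unique (equal refl refl) (equal refl _)    = refl
  line-unique (equal refl refl) (block _ _ _ a≢b _ _ _ _ _ _ _) = contradiction refl a≢b
  line-unique (block a _ _ _ _ _ _ _ _ _ _) (unitˡ a≡∞ _) = contradiction a≡∞ a
  line-unique (block _ b _ _ _ _ _ _ _ _ _) (unitʳ b≡∞ _) = contradiction b≡∞ b
  line-unique (block _ _ _ a≢b _ _ _ _ _ _ _) (equal _ a≡b) = contradiction a≡b a≢b
  line-unique {a} {b} {c} {d}
    (block a≢∞ b≢∞ c≢∞ a≢b a≢c b≢c {β} B ∞∈ a∈ b∈ c∈) (block _ _ d≢∞ _ a≢d b≢d {γ} C ∞∈′ a∈′ b∈′ d∈)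
    with steiner (∞ab a b) (∣∞ab∣ a≢∞ b≢∞ a≢b)
  ... | _ , _ , unique with unique (B , ∞ab⊆ ∞∈ a∈ b∈) | unique (C , ∞ab⊆ ∞∈′ a∈′ b∈′)
  ...   | refl | refl = ⁅⁆-injective (trans (rest c≢∞ a≢c b≢c c∈) (sym (rest d≢∞ a≢d b≢d d∈)))
    where
    rest : ∀ {x} → x ≢ ∞ → a ≢ x → b ≢ x → x ∈ β → ⁅ x ⁆ ≡ β ─ ∞ab a b
    rest x≢∞ a≢x b≢x x∈ =
      ⁅x⁆≡p (∣q─p∣≡ {q = β} (∞ab⊆ ∞∈ a∈ b∈) (∣∞ab∣ a≢∞ b≢∞ a≢b) (block-size B))
        (x∈p∧x∉q⇒x∈p─q x∈ λ x∈∞ab → case x∈p∪q⁻ ⁅ ∞ ⁆ _ x∈∞ab of λ where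
          (inj₁ x∈⁅∞⁆) → x≢∞ (x∈⁅y⁆⇒x≡y ∞ x∈⁅∞⁆)
          (inj₂ x∈ab) → case x∈p∪q⁻ ⁅ a ⁆ _ x∈ab of λ where
            (inj₁ x∈⁅a⁆) → a≢x (sym (x∈⁅y⁆⇒x≡y a x∈⁅a⁆))
            (inj₂ x∈⁅b⁆) → b≢x (sym (x∈⁅y⁆⇒x≡y b x∈⁅b⁆)))

  line : ∀ a b → ∃ (Line a b)
  line a b with a ≟ ∞ | b ≟ ∞ | a ≟ b
  ... | yes a≡∞ | _       | _       = b , unitˡ a≡∞ refl
  ... | no  _   | yes b≡∞ | _       = a , unitʳ b≡∞ refl
  ... | no  _   | no  _   | yes a≡b = ∞ , equal refl a≡b
  ... | no  a≢∞ | no  b≢∞ | no  a≢b with steiner (∞ab a b) (∣∞ab∣ a≢∞ b≢∞ a≢b)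
  ...   | β , (B , ⊆β) , _
    with ∣p∣≡1+k⇒nonempty (β ─ ∞ab a b) (∣q─p∣≡ {q = β} ⊆β (∣∞ab∣ a≢∞ b≢∞ a≢b) (block-size B))
  ...     | c , c∈ = c ,
    block a≢∞ b≢∞ (λ { refl → c∉ ∞∈ }) a≢b (λ { refl → c∉ a∈ }) (λ { refl → c∉ b∈ })
      B (⊆β ∞∈) (⊆β a∈) (⊆β b∈) (p─q⊆p β _ c∈)
    where
    c∉ : c ∉ ∞ab a b
    c∉ = x∈p─q⇒x∉q β _ c∈
    ∞∈ : ∞ ∈ ∞ab a b
    ∞∈ = x∈p∪q⁺ (inj₁ (x∈⁅x⁆ ∞))
    a∈ : a ∈ ∞ab a b
    a∈ = x∈p∪q⁺ {p = ⁅ ∞ ⁆} (inj₂ (x∈p∪q⁺ (inj₁ (x∈⁅x⁆ a))))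
    b∈ : b ∈ ∞ab a b
    b∈ = x∈p∪q⁺ {p = ⁅ ∞ ⁆} (inj₂ (x∈p∪q⁺ {p = ⁅ a ⁆} (inj₂ (x∈⁅x⁆ b))))

  infixl 7 _∙_ _⊙_

  -- What follows relies on the laws alone, so the case analysis inside `line` is kept from
  -- unfolding.
  abstract
    _∙_ : Fin n → Fin n → Fin n
    a ∙ b = proj₁ (line a b)

    line⇒∙ : ∀ {a b c} → Line a b c → a ∙ b ≡ c
    line⇒∙ = line-unique (proj₂ (line _ _))

    ∙-comm : ∀ a b → a ∙ b ≡ b ∙ a
    ∙-comm a b = line⇒∙ (swapˡ (proj₂ (line b a)))

    ∙-involutive : ∀ a b → a ∙ (a ∙ b) ≡ b
    ∙-involutive a b = line⇒∙ (swapʳ (proj₂ (line a b)))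

    ∙-self : ∀ a → a ∙ a ≡ ∞
    ∙-self a = line⇒∙ {a} {a} (equal refl refl)

    ∙-identityʳ : ∀ a → a ∙ ∞ ≡ a
    ∙-identityʳ a = line⇒∙ (unitʳ refl refl)

    a∙b≢∞ : ∀ {a b} → a ≢ b → a ∙ b ≢ ∞
    a∙b≢∞ {a} {b} a≢b eq =
      a≢b (trans (sym (∙-identityʳ a)) (trans (cong (a ∙_) (sym eq)) (∙-involutive a b)))

    a≢a∙b : ∀ {a b} → b ≢ ∞ → a ≢ a ∙ b
    a≢a∙b {a} {b} b≢∞ eq =
      b≢∞ (trans (sym (∙-involutive a b)) (trans (cong (a ∙_) (sym eq)) (∙-self a)))

    -- On the points other than ∞ this is the Steiner quasigroup of the derived
    -- triple system at ∞.
    _⊙_ : Fin n → Fin n → Fin n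
    a ⊙ b with a ≟ b
    ... | yes _ = a
    ... | no  _ = a ∙ b

    ⊙-comm : ∀ a b → a ⊙ b ≡ b ⊙ a
    ⊙-comm a b with a ≟ b | b ≟ a
    ... | yes a≡b | yes _   = a≡b
    ... | yes a≡b | no  b≢a = contradiction (sym a≡b) b≢a
    ... | no  a≢b | yes b≡a = contradiction (sym b≡a) a≢b
    ... | no  _   | no  _   = ∙-comm a b

    a⊙b≢∞ : ∀ {a b} → a ≢ ∞ → a ⊙ b ≢ ∞
    a⊙b≢∞ {a} {b} a≢∞ with a ≟ b
    ... | yes _   = a≢∞
    ... | no  a≢b = a∙b≢∞ a≢b

    -- Off the diagonal, b ≢ ∞ gives a ≢ a ∙ b, so both products are loop products. For b = ∞ and a
    -- ≢ ∞ the law fails, since a ⊙ ∞ = a and a ⊙ a = a.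
    ⊙-involutive : ∀ a {b} → b ≢ ∞ → a ⊙ (a ⊙ b) ≡ b
    ⊙-involutive a {b} b≢∞ with a ≟ b
    ... | yes a≡b with a ≟ a
    ...   | yes _   = a≡b
    ...   | no  a≢a = contradiction refl a≢a
    ⊙-involutive a {b} b≢∞ | no _ with a ≟ a ∙ b
    ...   | yes eq = contradiction eq (a≢a∙b b≢∞)
    ...   | no  _  = ∙-involutive a b

    -- Only meaningful on 2-sets; all other subsets get the junk value ∞.
    colour : Subset n → Fin n
    colour p with ∣ p ∣ ℕ.≟ 2
    ... | no  _     = ∞
    ... | yes ∣p∣≡2 = let x , y , _ = two-elements p ∣p∣≡2 in x ∙ y

    -- Commutativity of `_∙_` makes the order in which `two-elements` lists the pair immaterial.
    colour-pair : ∀ {p x y} → ∣ p ∣ ≡ 2 → x ≢ y → x ∈ p → y ∈ p → colour p ≡ x ∙ y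
    colour-pair {p} {x} {y} ∣p∣≡2 x≢y x∈p y∈p with ∣ p ∣ ℕ.≟ 2
    ... | no  ∣p∣≢2 = contradiction ∣p∣≡2 ∣p∣≢2
    ... | yes ∣p∣≡2 = let _ , _ , u≢v , u∈p , v∈p = two-elements p ∣p∣≡2 in match u≢v (∈xy u∈p) (∈xy v∈p)
      where
      ∈xy : ∀ {z} → z ∈ p → z ∈ ⁅ x ⁆ ⊎ z ∈ ⁅ y ⁆
      ∈xy z∈p = x∈p∪q⁻ ⁅ x ⁆ ⁅ y ⁆ (subst (_ ∈_) (sym (⁅x⁆∪⁅y⁆≡p ∣p∣≡2 x≢y x∈p y∈p)) z∈p)
      match : ∀ {u v} → u ≢ v → u ∈ ⁅ x ⁆ ⊎ u ∈ ⁅ y ⁆ → v ∈ ⁅ x ⁆ ⊎ v ∈ ⁅ y ⁆ → u ∙ v ≡ x ∙ y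
      match u≢v (inj₁ u) (inj₁ v) = contradiction (trans (x∈⁅y⁆⇒x≡y x u) (sym (x∈⁅y⁆⇒x≡y x v))) u≢v
      match u≢v (inj₁ u) (inj₂ v) = cong₂ _∙_ (x∈⁅y⁆⇒x≡y x u) (x∈⁅y⁆⇒x≡y y v)
      match u≢v (inj₂ u) (inj₁ v) = trans (cong₂ _∙_ (x∈⁅y⁆⇒x≡y y u) (x∈⁅y⁆⇒x≡y x v)) (∙-comm y x)
      match u≢v (inj₂ u) (inj₂ v) = contradiction (trans (x∈⁅y⁆⇒x≡y y u) (sym (x∈⁅y⁆⇒x≡y y v))) u≢v

    colour≢∞ : ∀ p → ∣ p ∣ ≡ 2 → colour p ≢ ∞
    colour≢∞ p ∣p∣≡2 eq with two-elements p ∣p∣≡2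
    ... | x , y , x≢y , x∈p , y∈p = a∙b≢∞ x≢y (trans (sym (colour-pair ∣p∣≡2 x≢y x∈p y∈p)) eq)

  Shifted : Fin n → SubsetRel n
  Shifted s p q = colour p ⊙ colour q ≡ s

  -- The equation colour T ⊙ colour q = s forces colour q = d, where d = colour T ⊙ s. The only pair
  -- of colour d through x is {x, x ∙ d}, because x ∙ y = d means y = x ∙ d.
  shifted-perfect : ∀ {s} → s ≢ ∞ → Perfect (Shifted s)
  shifted-perfect {s} s≢∞ T U ∣T∣ ∣U∣ with ∣p∣≡1⇒singleton U ∣U∣
  ... | x , refl = ⁅ x ⁆ ∪ ⁅ x ∙ d ⁆ , ((∣q∣ , Rq) , p⊆p∪q _) , unique
    where
    d = colour T ⊙ s
    x≢x∙d : x ≢ x ∙ d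
    x≢x∙d = a≢a∙b (a⊙b≢∞ (colour≢∞ T ∣T∣))
    ∣q∣ : ∣ ⁅ x ⁆ ∪ ⁅ x ∙ d ⁆ ∣ ≡ 2
    ∣q∣ = ∣⁅x⁆∪⁅y⁆∣ x≢x∙d
    Rq : Shifted s T (⁅ x ⁆ ∪ ⁅ x ∙ d ⁆)
    Rq = trans (cong (colour T ⊙_) (trans
           (colour-pair ∣q∣ x≢x∙d (x∈p∪q⁺ (inj₁ (x∈⁅x⁆ x))) (x∈p∪q⁺ {p = ⁅ x ⁆} (inj₂ (x∈⁅x⁆ (x ∙ d)))))
           (∙-involutive x d))) (⊙-involutive (colour T) s≢∞)
    unique : ∀ {q} → (∣ q ∣ ≡ 2 × Shifted s T q) × ⁅ x ⁆ ⊆ q → ⁅ x ⁆ ∪ ⁅ x ∙ d ⁆ ≡ q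
    unique {q} ((∣q∣ , R) , x⊆q) with other q ∣q∣ (x⊆q (x∈⁅x⁆ x))
    ... | y , x≢y , y∈q = trans (cong (λ z → ⁅ x ⁆ ∪ ⁅ z ⁆) (sym y≡)) (⁅x⁆∪⁅y⁆≡p ∣q∣ x≢y (x⊆q (x∈⁅x⁆ x)) y∈q)
      where
      open ≡-Reasoning
      y≡ : y ≡ x ∙ d
      y≡ = begin
        y                                      ≡⟨ ∙-involutive x y ⟨
        x ∙ (x ∙ y)                            ≡⟨ cong (x ∙_) (colour-pair ∣q∣ x≢y (x⊆q (x∈⁅x⁆ x)) y∈q) ⟨
        x ∙ colour q                           ≡⟨ cong (x ∙_) (⊙-involutive (colour T) (colour≢∞ q ∣q∣)) ⟨
        x ∙ (colour T ⊙ (colour T ⊙ colour q)) ≡⟨ cong (λ z → x ∙ (colour T ⊙ z)) R ⟩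
        x ∙ d                                  ∎

  flip-perfect : ∀ {s} → Perfect (Shifted s) → Perfect (flip (Shifted s))
  flip-perfect perfect T U ∣T∣ ∣U∣ with perfect T U ∣T∣ ∣U∣
  ... | q , ((∣q∣ , R) , U⊆q) , unique =
    q , ((∣q∣ , trans (⊙-comm (colour q) (colour T)) R) , U⊆q) ,
    λ {q′} ((∣q′∣ , R′) , U⊆) → unique ((∣q′∣ , trans (⊙-comm (colour T) (colour q′)) R′) , U⊆)

-- Counting in lists

indicator : {P : Set ℓ₁} → Dec P → ℕ
indicator P? = if does P? then 1 else 0

indicator-yes : {P : Set ℓ₁} (P? : Dec P) → P → indicator P? ≡ 1
indicator-yes (yes _) _ = refl
indicator-yes (no ¬p) p = contradiction p ¬p

indicator-no : {P : Set ℓ₁} (P? : Dec P) → ¬ P → indicator P? ≡ 0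
indicator-no (yes p) ¬p = contradiction p ¬p
indicator-no (no _)  _  = refl

indicator-cong : {P : Set ℓ₁} {Q : Set ℓ₂} (P? : Dec P) (Q? : Dec Q) → P ⇔ Q → indicator P? ≡ indicator Q?
indicator-cong (yes p) Q? P⇔Q = sym (indicator-yes Q? (to P⇔Q p))
indicator-cong (no ¬p) Q? P⇔Q = sym (indicator-no Q? (¬p ∘ from P⇔Q))

count : {P : Pred X ℓ₁} → Decidable P → List X → ℕ
count P? xs = length (filter P? xs)

module _ {X : Set α} {P : Pred X ℓ₁} (P? : Decidable P) where
  count-∷ : ∀ x xs → count P? (x ∷ xs) ≡ indicator (P? x) + count P? xs
  count-∷ x xs with P? x
  ... | yes _ = refl
  ... | no  _ = refl

  count-++ : ∀ xs ys → count P? (xs ++ˡ ys) ≡ count P? xs + count P? ys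
  count-++ xs ys = trans (cong length (filter-++ P? xs ys)) (length-++ (filter P? xs))

  count-none : (∀ x → ¬ P x) → ∀ xs → count P? xs ≡ 0
  count-none ¬P []       = refl
  count-none ¬P (x ∷ xs) = trans (count-∷ x xs) (cong₂ _+_ (indicator-no (P? x) (¬P x)) (count-none ¬P xs))

  count-repeat : ∀ k xs → count P? (concat (replicate k xs)) ≡ k * count P? xs
  count-repeat zero    xs = refl
  count-repeat (suc k) xs = trans (count-++ xs _) (cong (count P? xs +_) (count-repeat k xs))

  count-sum : ∀ xs → count P? xs ≡ sum (map (indicator ∘ P?) xs)
  count-sum []       = refl
  count-sum (x ∷ xs) = trans (count-∷ x xs) (cong (indicator (P? x) +_) (count-sum xs))

length-repeat : ∀ k (xs : List X) → length (concat (replicate k xs)) ≡ k * length xs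
length-repeat zero    xs = refl
length-repeat (suc k) xs = trans (length-++ xs) (cong (length xs +_) (length-repeat k xs))

count-cong : {P : Pred X ℓ₁} {Q : Pred X ℓ₂} (P? : Decidable P) (Q? : Decidable Q) →
             (∀ x → P x ⇔ Q x) → ∀ xs → count P? xs ≡ count Q? xs
count-cong P? Q? P⇔Q []       = refl
count-cong P? Q? P⇔Q (x ∷ xs) = trans (count-∷ P? x xs) (trans
  (cong₂ _+_ (indicator-cong (P? x) (Q? x) (P⇔Q x)) (count-cong P? Q? P⇔Q xs)) (sym (count-∷ Q? x xs)))

count-map : {P : Pred Y ℓ₁} (P? : Decidable P) (f : X → Y) → ∀ xs → count P? (map f xs) ≡ count (P? ∘ f) xs
count-map P? f []       = refl
count-map P? f (x ∷ xs) = trans (count-∷ P? (f x) _)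
  (trans (cong (indicator (P? (f x)) +_) (count-map P? f xs)) (sym (count-∷ (P? ∘ f) x xs)))

module _ {P : Pred Z ℓ₁} (P? : Decidable P) (f : X → Y → Z) where
  -- If the predicate depends on the left argument alone, the pairing does not affect the count;
  -- equal lengths keep `zipWith` from truncating. The right-hand version is analogous.
  count-zipWithˡ : {Q : Pred X ℓ₂} (Q? : Decidable Q) → (∀ x y → P (f x y) ⇔ Q x) →
                   ∀ xs ys → length xs ≡ length ys → count P? (zipWith f xs ys) ≡ count Q? xs
  count-zipWithˡ Q? P⇔Q []       []       _  = refl
  count-zipWithˡ Q? P⇔Q (x ∷ xs) (y ∷ ys) eq = trans (count-∷ P? (f x y) _) (trans
    (cong₂ _+_ (indicator-cong (P? (f x y)) (Q? x) (P⇔Q x y)) (count-zipWithˡ Q? P⇔Q xs ys (suc-injective eq)))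
    (sym (count-∷ Q? x xs)))

  count-zipWithʳ : {Q : Pred Y ℓ₂} (Q? : Decidable Q) → (∀ x y → P (f x y) ⇔ Q y) →
                   ∀ xs ys → length xs ≡ length ys → count P? (zipWith f xs ys) ≡ count Q? ys
  count-zipWithʳ Q? P⇔Q []       []       _  = refl
  count-zipWithʳ Q? P⇔Q (x ∷ xs) (y ∷ ys) eq = trans (count-∷ P? (f x y) _) (trans
    (cong₂ _+_ (indicator-cong (P? (f x y)) (Q? y) (P⇔Q x y)) (count-zipWithʳ Q? P⇔Q xs ys (suc-injective eq)))
    (sym (count-∷ Q? y ys)))

sum-map-+ : (f g : X → ℕ) → ∀ xs → sum (map (λ x → f x + g x) xs) ≡ sum (map f xs) + sum (map g xs)
sum-map-+ f g []       = refl
sum-map-+ f g (x ∷ xs) = trans (cong (f x + g x +_) (sum-map-+ f g xs)) (interchange (f x) (g x) _ _)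
  where
  interchange : ∀ a b c d → a + b + (c + d) ≡ a + c + (b + d)
  interchange = solve-∀

sum-map-cong : {f g : X → ℕ} → (∀ x → f x ≡ g x) → ∀ xs → sum (map f xs) ≡ sum (map g xs)
sum-map-cong f≗g []       = refl
sum-map-cong f≗g (x ∷ xs) = cong₂ _+_ (f≗g x) (sum-map-cong f≗g xs)

sum-map-1 : (xs : List X) → sum (map (λ _ → 1) xs) ≡ length xs
sum-map-1 []       = refl
sum-map-1 (x ∷ xs) = cong suc (sum-map-1 xs)

sum-map-const-on : {P : Pred X ℓ₁} (P? : Decidable P) (f : X → ℕ) (k : ℕ) →
                   (∀ x → P x → f x ≡ k) → (∀ x → ¬ P x → f x ≡ 0) →
                   ∀ xs → sum (map f xs) ≡ count P? xs * k
sum-map-const-on P? f k on off []       = refl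
sum-map-const-on P? f k on off (x ∷ xs) with P? x
... | yes px = cong₂ _+_ (on x px) (sum-map-const-on P? f k on off xs)
... | no ¬px = cong₂ _+_ (off x ¬px) (sum-map-const-on P? f k on off xs)

-- Both sides count the related pairs, once by rows and once by columns.
double-count : {R : REL X Y ℓ₁} (R? : B.Decidable R) → ∀ xs ys →
               sum (map (λ x → count (R? x) ys) xs) ≡ sum (map (λ y → count (λ x → R? x y) xs) ys)
double-count R? []       ys = sym (zeros ys)
  where
  zeros : (ys : List X) → sum (map (λ _ → 0) ys) ≡ 0
  zeros []       = refl
  zeros (_ ∷ ys) = zeros ys
double-count R? (x ∷ xs) ys = begin
  count (R? x) ys + sum (map (λ x → count (R? x) ys) xs)
    ≡⟨ cong₂ _+_ (count-sum (R? x) ys) (double-count R? xs ys) ⟩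
  sum (map (λ y → indicator (R? x y)) ys) + sum (map (λ y → count (λ x → R? x y) xs) ys)
    ≡⟨ sum-map-+ (λ y → indicator (R? x y)) _ ys ⟨
  sum (map (λ y → indicator (R? x y) + count (λ x → R? x y) xs) ys)
    ≡⟨ sum-map-cong (λ y → sym (count-∷ (λ x → R? x y) x xs)) ys ⟩
  sum (map (λ y → count (λ x → R? x y) (x ∷ xs)) ys)
    ∎
  where open ≡-Reasoning

count-allFin-suc : {P : Pred (Fin (suc n)) ℓ₁} (P? : Decidable P) →
                   count P? (allFin (suc n)) ≡ indicator (P? zero) + count (P? ∘ suc) (allFin n)
count-allFin-suc {n} P? = trans (count-∷ P? zero _) (cong (indicator (P? zero) +_) (trans
  (cong (count P?) (sym (map-tabulate {n = n} (λ i → i) suc))) (count-map P? suc (allFin n))))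

count-∈ : (p : Subset n) → count (_∈? p) (allFin n) ≡ ∣ p ∣
count-∈ []            = refl
count-∈ p@(inside ∷ q) = trans (count-allFin-suc (_∈? p)) (cong₂ _+_ (indicator-yes (zero ∈? p) here)
  (trans (count-cong _ (_∈? q) (λ x → mk⇔ drop-there there) (allFin _)) (count-∈ q)))
count-∈ p@(outside ∷ q) = trans (count-allFin-suc (_∈? p)) (cong₂ _+_ (indicator-no (zero ∈? p) λ ())
  (trans (count-cong _ (_∈? q) (λ x → mk⇔ drop-there there) (allFin _)) (count-∈ q)))

count-∉ : (p : Subset n) → count (λ x → ¬? (x ∈? p)) (allFin n) ≡ n ∸ ∣ p ∣
count-∉ p = trans (count-cong _ (_∈? ∁ p) (λ x → mk⇔ x∉p⇒x∈∁p x∈∁p⇒x∉p) (allFin _))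
                  (trans (count-∈ (∁ p)) (∣∁p∣≡n∸∣p∣ p))

count-≡1 : {P : Pred (Fin n) ℓ₁} (P? : Decidable P) (y : Fin n) → (∀ x → P x ⇔ y ≡ x) → count P? (allFin n) ≡ 1
count-≡1 P? y P⇔ = trans
  (count-cong P? (_∈? ⁅ y ⁆) (λ x → mk⇔ (λ px → subst (_∈ ⁅ y ⁆) (to (P⇔ x) px) (x∈⁅x⁆ y))
                                         (λ x∈ → from (P⇔ x) (sym (x∈⁅y⁆⇒x≡y y x∈)))) (allFin _))
  (trans (count-∈ ⁅ y ⁆) (∣⁅x⁆∣≡1 y))

-- The number of systems in a large set

extension-point : (𝒮 : SteinerSystem 3 4 n) → ∀ T → ∣ T ∣ ≡ 3 → ∃ λ y → ∀ x → Block 𝒮 (T ∪ ⁅ x ⁆) ⇔ y ≡ x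
extension-point 𝒮 T ∣T∣ with extension 𝒮 T ∣T∣
... | U , ∣U∣ , B , unique with ∣p∣≡1⇒singleton U ∣U∣
...   | y , refl = y , λ x → mk⇔ (λ B′ → ⁅⁆-injective (unique (∣⁅x⁆∣≡1 x) B′)) (λ { refl → B })

-- Fix a triple `T`. Each system completes it by exactly one point, and each of the k points outside
-- `T` completes it in μ of the systems.
length-systems : ∀ {k μ} (L : LargeSet 3 4 (3 + k) μ) → length (LargeSet.systems L) ≡ k * μ
length-systems {k} {μ} L = begin
  length systems
    ≡⟨ sum-map-1 systems ⟨
  sum (map (λ _ → 1) systems)
    ≡⟨ sum-map-cong (λ 𝒮 → sym (one 𝒮)) systems ⟩
  sum (map (λ 𝒮 → count (λ x → block? 𝒮 (T ∪ ⁅ x ⁆)) (allFin _)) systems)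
    ≡⟨ double-count (λ 𝒮 x → block? 𝒮 (T ∪ ⁅ x ⁆)) systems (allFin _) ⟩
  sum (map (λ x → count (λ 𝒮 → block? 𝒮 (T ∪ ⁅ x ⁆)) systems) (allFin _))
    ≡⟨ sum-map-const-on (λ x → ¬? (x ∈? T)) _ μ outside-T inside-T (allFin _) ⟩
  count (λ x → ¬? (x ∈? T)) (allFin _) * μ
    ≡⟨ cong (_* μ) (trans (count-∉ T) (cong (3 + k ∸_) ∣T∣)) ⟩
  k * μ
    ∎
  where
  open ≡-Reasoning
  open LargeSet L
  T : Subset (3 + k)
  T = inside ∷ inside ∷ inside ∷ ⊥
  ∣T∣ : ∣ T ∣ ≡ 3
  ∣T∣ = cong (3 +_) (∣⊥∣≡0 k)
  one : ∀ 𝒮 → count (λ x → block? 𝒮 (T ∪ ⁅ x ⁆)) (allFin _) ≡ 1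
  one 𝒮 with extension-point 𝒮 T ∣T∣
  ... | y , B⇔ = count-≡1 (λ x → block? 𝒮 (T ∪ ⁅ x ⁆)) y B⇔
  outside-T : ∀ x → x ∉ T → count (λ 𝒮 → block? 𝒮 (T ∪ ⁅ x ⁆)) systems ≡ μ
  outside-T x x∉T = covering _ (trans (cong ∣_∣ (∪-comm T ⁅ x ⁆)) (trans (∣⁅x⁆∪p∣ x∉T) (cong suc ∣T∣)))
  inside-T : ∀ x → ¬ (x ∉ T) → count (λ 𝒮 → block? 𝒮 (T ∪ ⁅ x ⁆)) systems ≡ 0
  inside-T x ¬x∉T with x ∈? T
  ... | yes x∈T = count-none _ (λ 𝒮 → ¬block-⊆ 𝒮 ∣T∣ (⁅x⁆⊆ x∈T)) systems
  ... | no  x∉T = contradiction x∉T ¬x∉T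

-- Symbol frequencies in the columns of a perpendicular array

entries-∪ : ∀ {m n} (f : Fin m → Fin n) i j → entries f (⁅ i ⁆ ∪ ⁅ j ⁆) ≡ ⁅ f i ⁆ ∪ ⁅ f j ⁆
entries-∪ f i j = ⊆-antisym ⊆ʳ (∪-least
  (⁅x⁆⊆ (∈entries⁺ f _ (x∈p∪q⁺ (inj₁ (x∈⁅x⁆ i))))) (⁅x⁆⊆ (∈entries⁺ f _ (x∈p∪q⁺ {p = ⁅ i ⁆} (inj₂ (x∈⁅x⁆ j))))))
  where
  ⊆ʳ : entries f (⁅ i ⁆ ∪ ⁅ j ⁆) ⊆ ⁅ f i ⁆ ∪ ⁅ f j ⁆
  ⊆ʳ y∈ with ∈entries⁻ f (⁅ i ⁆ ∪ ⁅ j ⁆) y∈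
  ... | x , x∈ , refl with x∈p∪q⁻ ⁅ i ⁆ ⁅ j ⁆ x∈
  ...   | inj₁ x∈i = x∈p∪q⁺ (inj₁ (subst (λ z → f x ∈ ⁅ f z ⁆) (x∈⁅y⁆⇒x≡y i x∈i) (x∈⁅x⁆ (f x))))
  ...   | inj₂ x∈j = x∈p∪q⁺ {p = ⁅ f i ⁆} (inj₂ (subst (λ z → f x ∈ ⁅ f z ⁆) (x∈⁅y⁆⇒x≡y j x∈j) (x∈⁅x⁆ (f x))))

pair-cancel : {x y z : Fin n} → x ≢ y → ⁅ x ⁆ ∪ ⁅ y ⁆ ≡ ⁅ x ⁆ ∪ ⁅ z ⁆ → y ≡ z
pair-cancel {x = x} {y} {z} x≢y eq with x∈p∪q⁻ ⁅ x ⁆ ⁅ z ⁆ (subst (y ∈_) eq (x∈p∪q⁺ {p = ⁅ x ⁆} (inj₂ (x∈⁅x⁆ y))))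
... | inj₁ y∈x = contradiction (sym (x∈⁅y⁆⇒x≡y x y∈x)) x≢y
... | inj₂ y∈z = x∈⁅y⁆⇒x≡y z y∈z

count-pairs : {x y : Fin n} → x ≢ y → ∀ d →
              count (λ e → (⁅ x ⁆ ∪ ⁅ y ⁆) ≟ˢ (⁅ d ⁆ ∪ ⁅ e ⁆)) (allFin n) ≡ indicator (x ≟ d) + indicator (y ≟ d)
count-pairs {x = x} {y} x≢y d with x ≟ d | y ≟ d
... | yes refl | yes refl = contradiction refl x≢y
... | yes refl | no  _    = count-≡1 _ y λ e → mk⇔ (pair-cancel x≢y) (λ { refl → refl })
... | no  _    | yes refl = count-≡1 _ x λ e →
  mk⇔ (λ eq → pair-cancel (x≢y ∘ sym) (trans (∪-comm ⁅ y ⁆ ⁅ x ⁆) eq)) (λ { refl → ∪-comm ⁅ x ⁆ ⁅ y ⁆ })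
... | no  x≢d  | no  y≢d  = count-none (λ e → (⁅ x ⁆ ∪ ⁅ y ⁆) ≟ˢ (⁅ d ⁆ ∪ ⁅ e ⁆)) (λ e eq →
  case x∈p∪q⁻ ⁅ x ⁆ ⁅ y ⁆ (subst (d ∈_) (sym eq) (x∈p∪q⁺ (inj₁ (x∈⁅x⁆ d)))) of λ where
    (inj₁ d∈x) → x≢d (sym (x∈⁅y⁆⇒x≡y x d∈x))
    (inj₂ d∈y) → y≢d (sym (x∈⁅y⁆⇒x≡y y d∈y))) (allFin _)

module Columns {lam ℓ n} (PA : PerpendicularArray lam 2 ℓ n) where
  open PerpendicularArray PA

  rows : List (Fin (lam * (n C 2)))
  rows = allFin _

  column-count : Fin ℓ → Fin n → ℕ
  column-count i d = count (λ r → matrix r i ≟ d) rows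

  -- Count the pairs (r, e) for which row r has entry set {d, e} in columns i and j. A row showing d
  -- in one of these columns has exactly one such e, any other row none; each of the n - 1 symbols e
  -- other than d arises from `lam` rows.
  two-columns : ∀ {i j} → i ≢ j → ∀ d → column-count i d + column-count j d ≡ (n ∸ 1) * lam
  two-columns {i} {j} i≢j d = begin
    column-count i d + column-count j d
      ≡⟨ cong₂ _+_ (count-sum _ rows) (count-sum _ rows) ⟩
    sum (map (λ r → indicator (matrix r i ≟ d)) rows) + sum (map (λ r → indicator (matrix r j ≟ d)) rows)
      ≡⟨ sum-map-+ (λ r → indicator (matrix r i ≟ d)) _ rows ⟨
    sum (map (λ r → indicator (matrix r i ≟ d) + indicator (matrix r j ≟ d)) rows)
      ≡⟨ sum-map-cong row rows ⟩
    sum (map (λ r → count (λ e → entries (matrix r) (⁅ i ⁆ ∪ ⁅ j ⁆) ≟ˢ (⁅ d ⁆ ∪ ⁅ e ⁆)) (allFin n)) rows)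
      ≡⟨ double-count (λ r e → entries (matrix r) (⁅ i ⁆ ∪ ⁅ j ⁆) ≟ˢ (⁅ d ⁆ ∪ ⁅ e ⁆)) rows (allFin n) ⟩
    sum (map (λ e → count (λ r → entries (matrix r) (⁅ i ⁆ ∪ ⁅ j ⁆) ≟ˢ (⁅ d ⁆ ∪ ⁅ e ⁆)) rows) (allFin n))
      ≡⟨ sum-map-const-on (λ e → ¬? (e ∈? ⁅ d ⁆)) _ lam
           (λ e e∉d → balanced _ (∣⁅x⁆∪⁅y⁆∣ i≢j) _ (∣⁅x⁆∪⁅y⁆∣ {x = d} {e} λ { refl → e∉d (x∈⁅x⁆ d) })) same (allFin n) ⟩
    count (λ e → ¬? (e ∈? ⁅ d ⁆)) (allFin n) * lam
      ≡⟨ cong (_* lam) (trans (count-∉ ⁅ d ⁆) (cong (n ∸_) (∣⁅x⁆∣≡1 d))) ⟩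
    (n ∸ 1) * lam
      ∎
    where
    open ≡-Reasoning
    row : ∀ r → indicator (matrix r i ≟ d) + indicator (matrix r j ≟ d) ≡
                count (λ e → entries (matrix r) (⁅ i ⁆ ∪ ⁅ j ⁆) ≟ˢ (⁅ d ⁆ ∪ ⁅ e ⁆)) (allFin n)
    row r rewrite entries-∪ (matrix r) i j = sym (count-pairs (i≢j ∘ row-distinct r) d)
    same : ∀ e → ¬ (e ∉ ⁅ d ⁆) → count (λ r → entries (matrix r) (⁅ i ⁆ ∪ ⁅ j ⁆) ≟ˢ (⁅ d ⁆ ∪ ⁅ e ⁆)) rows ≡ 0
    same e ¬e∉d with e ∈? ⁅ d ⁆
    ... | no  e∉d = contradiction e∉d ¬e∉d
    ... | yes e∈d with x∈⁅y⁆⇒x≡y d e∈d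
    -- For e = d the target is a singleton, whereas two columns of a row have two distinct entries.
    ...   | refl = count-none _ (λ r eq → case
      trans (sym (∣⁅x⁆∪⁅y⁆∣ i≢j)) (trans (sym (∣entries∣ (matrix r) (row-distinct r) _))
        (trans (cong ∣_∣ (trans eq (∪-idem ⁅ d ⁆))) (∣⁅x⁆∣≡1 d))) of λ ()) rows

  -- The three pairwise sums of the column counts agree, so adding the two that involve i and
  -- subtracting the third leaves twice the count of i.
  three-columns : ∀ {i j k} → i ≢ j → i ≢ k → j ≢ k → ∀ d → 2 * column-count i d ≡ (n ∸ 1) * lam
  three-columns {i} {j} {k} i≢j i≢k j≢k d = +-cancelʳ-≡ _ _ _ (begin
    2 * cᵢ + (cⱼ + cₖ)     ≡⟨ regroup cᵢ cⱼ cₖ ⟩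
    (cᵢ + cⱼ) + (cᵢ + cₖ)  ≡⟨ cong₂ _+_ (two-columns i≢j d) (trans (two-columns i≢k d) (sym (two-columns j≢k d))) ⟩
    (n ∸ 1) * lam + (cⱼ + cₖ) ∎)
    where
    open ≡-Reasoning
    cᵢ = column-count i d
    cⱼ = column-count j d
    cₖ = column-count k d
    regroup : ∀ a b c → 2 * a + (b + c) ≡ (a + b) + (a + c)
    regroup = solve-∀

column-balanced : ∀ {k g n} (PA : PerpendicularArray (2 * g) 2 (3 + k) n) →
                  ∀ i d → Columns.column-count PA i d ≡ g * (n ∸ 1)
column-balanced {k} {g} {n} PA i d = *-cancelˡ-≡ _ _ 2 (trans (double i) (reorder (n ∸ 1) g))
  where
  open Columns PA
  reorder : ∀ m g → m * (2 * g) ≡ 2 * (g * m)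
  reorder = solve-∀
  double : ∀ i → 2 * column-count i d ≡ (n ∸ 1) * (2 * g)
  double zero          = three-columns {j = suc zero} {k = suc (suc zero)} (λ ()) (λ ()) (λ ()) d
  double (suc zero)    = three-columns {j = zero} {k = suc (suc zero)} (λ ()) (λ ()) (λ ()) d
  double (suc (suc i)) = three-columns {j = zero} {k = suc zero} (λ ()) (λ ()) (λ ()) d

-- The doubled large set

module _ {n} {R A A′ : SubsetRel n} (H : Half R A) (H′ : Half (flip R) A′) where
  -- Pairs have two points on the first copy and the blocks from `A′` at most one.
  split-heavy : ∀ {p q} → 3 ≤ ∣ p ∣ → Split R A A′ p q ⇔ A p q
  split-heavy {p} {q} 3≤ = mk⇔ ⇒ (inj₂ ∘ inj₁)
    where
    ⇒ : Split R A A′ p q → A p q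
    ⇒ (inj₁ (∣p∣ , _))  = contradiction (subst (3 ≤_) ∣p∣ 3≤) λ { (s≤s (s≤s ())) }
    ⇒ (inj₂ (inj₁ a))  = a
    ⇒ (inj₂ (inj₂ a′)) = contradiction (≤-trans 3≤ (Half.A-thin H′ a′)) λ { (s≤s ()) }

  split-balanced : ∀ {p q} → ∣ p ∣ ≡ 2 → ∣ q ∣ ≡ 2 → Split R A A′ p q ⇔ R p q
  split-balanced {p} {q} ∣p∣ ∣q∣ = mk⇔ ⇒ (λ r → inj₁ (∣p∣ , ∣q∣ , r))
    where
    ⇒ : Split R A A′ p q → R p q
    ⇒ (inj₁ (_ , _ , r)) = r
    ⇒ (inj₂ (inj₁ a))   = contradiction (subst (_≤ 1) ∣q∣ (Half.A-thin H a)) λ { (s≤s ()) }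
    ⇒ (inj₂ (inj₂ a′))  = contradiction (subst (_≤ 1) ∣p∣ (Half.A-thin H′ a′)) λ { (s≤s ()) }

split-light : {R A A′ : SubsetRel n} → Half R A → Half (flip R) A′ →
              ∀ {p q} → 3 ≤ ∣ q ∣ → Split R A A′ p q ⇔ A′ q p
split-light {R = R} {A} {A′} H H′ 3≤ = mk⇔
  (to (split-heavy H′ H 3≤) ∘ Split-swap R A A′) (inj₂ ∘ inj₂)

-- The repeated system has all 4-subsets as blocks. The conditions on N and m are conditional on a
-- 3-subset or 4-subset being present, so that N = 2 fits as well as N = 4.
trivialLargeSet : ∀ {N μ} m → m ≢ 0 → (∀ (T : Subset N) → ∣ T ∣ ≡ 3 → N ≡ 4) →
                  (∀ (K : Subset N) → ∣ K ∣ ≡ 4 → m ≡ μ) → LargeSet 3 4 N μ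
trivialLargeSet {N} {μ} m m≢0 N≡4 m≡μ = record
  { systems  = replicate m 𝒮
  ; nonempty = λ eq → m≢0 (trans (sym (length-replicate m)) (cong length eq))
  ; covering = λ K ∣K∣ → trans (all m K ∣K∣) (m≡μ K ∣K∣)
  }
  where
  𝒮 : SteinerSystem 3 4 N
  𝒮 = record
    { Block      = λ b → ∣ b ∣ ≡ 4
    ; block?     = λ b → ∣ b ∣ ℕ.≟ 4
    ; block-size = λ ∣b∣ → ∣b∣
    ; steiner    = λ T ∣T∣ → ⊤ , (trans (∣⊤∣≡n N) (N≡4 T ∣T∣) , ⊆⊤) ,
                    λ (∣b∣ , _) → sym (∣p∣≡n⇒p≡⊤ (trans ∣b∣ (sym (N≡4 T ∣T∣))))
    }
  all : ∀ m K → ∣ K ∣ ≡ 4 → count (λ 𝒮 → block? 𝒮 K) (replicate m 𝒮) ≡ m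
  all zero    K ∣K∣ = refl
  all (suc m) K ∣K∣ = trans (count-∷ (λ 𝒮 → block? 𝒮 K) 𝒮 _) (cong₂ _+_ (indicator-yes (block? 𝒮 K) ∣K∣) (all m K ∣K∣))

sum≡4 : ∀ {a b} → a + b ≡ 4 →
        (a ≡ 4 × b ≡ 0) ⊎ (a ≡ 3 × b ≡ 1) ⊎ (a ≡ 2 × b ≡ 2) ⊎ (a ≡ 1 × b ≡ 3) ⊎ (a ≡ 0 × b ≡ 4)
sum≡4 {4} refl = inj₁ (refl , refl)
sum≡4 {3} refl = inj₂ (inj₁ (refl , refl))
sum≡4 {2} refl = inj₂ (inj₂ (inj₁ (refl , refl)))
sum≡4 {1} refl = inj₂ (inj₂ (inj₂ (inj₁ (refl , refl))))
sum≡4 {0} refl = inj₂ (inj₂ (inj₂ (inj₂ (refl , refl))))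

-- Block multiplicities in the two families

module Doubling {k g} (PA : PerpendicularArray (2 * g) 2 (3 + k) (3 + k))
                (L : LargeSet 3 4 (3 + k) (g * (2 + k))) (𝒮₀ : SteinerSystem 3 4 (3 + k)) where
  open PerpendicularArray PA
  open LargeSet L
  open Columns PA
  open Loop 𝒮₀ zero
  open ≡-Reasoning

  private
    N = 3 + k

  -- With ∞ = zero, the colours are the suc s for s : Fin (2 + k).
  shifts : List (Fin (2 + k))
  shifts = concat (replicate (k * g) (allFin (2 + k)))

  length-shifts : length systems ≡ length shifts
  length-shifts = begin
    length systems                       ≡⟨ length-systems L ⟩
    k * (g * (2 + k))                    ≡⟨ *-assoc k g (2 + k) ⟨
    k * g * (2 + k)                      ≡⟨ cong (k * g *_) (length-tabulate {n = 2 + k} (λ i → i)) ⟨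
    k * g * length (allFin (2 + k))      ≡⟨ length-repeat (k * g) (allFin (2 + k)) ⟨
    length shifts                        ∎

  shifted-half : (s : Fin (2 + k)) (𝒮 : SteinerSystem 3 4 N) → Half (Shifted (suc s)) (Pure 𝒮)
  shifted-half s 𝒮 = half-pure 𝒮 (λ p q → colour p ⊙ colour q ≟ suc s) (shifted-perfect (λ ()))

  shifted-half′ : (s : Fin (2 + k)) (𝒮 : SteinerSystem 3 4 N) → Half (flip (Shifted (suc s))) (Pure 𝒮)
  shifted-half′ s 𝒮 = half-pure 𝒮 (λ p q → colour q ⊙ colour p ≟ suc s) (flip-perfect (shifted-perfect (λ ())))

  shifted : SteinerSystem 3 4 N → Fin (2 + k) → SteinerSystem 3 4 (N + N)
  shifted 𝒮 s = doubled (shifted-half s 𝒮) (shifted-half′ s 𝒮)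

  abstract
    inverse : ∀ r y → ∃ λ x → matrix r x ≡ y
    inverse r = injective⇒surjective (row-distinct r)

    _⁻¹ : Fin (2 * g * (N C 2)) → Fin N → Fin N
    (r ⁻¹) y = proj₁ (inverse r y)

    inverseʳ : ∀ r y → matrix r ((r ⁻¹) y) ≡ y
    inverseʳ r y = proj₂ (inverse r y)

    inverseˡ : ∀ r x → (r ⁻¹) (matrix r x) ≡ x
    inverseˡ r x = row-distinct r (inverseʳ r (matrix r x))

  Image : Fin (2 * g * (N C 2)) → SubsetRel N
  Image r p q = entries (matrix r) p ≡ q

  twisted-half : ∀ r → Half (Image r) (Twisted 𝒮₀ (r ⁻¹))
  twisted-half r = half-twisted 𝒮₀ {matrix r} {r ⁻¹} (inverseʳ r) (inverseˡ r)
    (λ p q → entries (matrix r) p ≟ˢ q) (λ _ _ e → e) (λ _ _ e → e)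

  -- The same construction for the inverse permutation: π(q) = p amounts to π⁻¹(p) = q.
  twisted-half′ : ∀ r → Half (flip (Image r)) (Twisted 𝒮₀ (matrix r))
  twisted-half′ r = half-twisted 𝒮₀ {r ⁻¹} {matrix r} (inverseˡ r) (inverseʳ r) (λ p q → entries (matrix r) q ≟ˢ p)
    (λ p q eq → trans (cong (entries (r ⁻¹)) (sym eq)) (entries-inverse (r ⁻¹) (matrix r) (inverseˡ r) q))
    (λ p q eq → trans (cong (entries (matrix r)) (sym eq)) (entries-inverse (matrix r) (r ⁻¹) (inverseʳ r) p))

  twisted : Fin (2 * g * (N C 2)) → SteinerSystem 3 4 (N + N)
  twisted r = doubled (twisted-half r) (twisted-half′ r)

  -- Any matching of systems with shifts will do: whether a given 4-subset is a block of
  -- `shifted 𝒮 s` depends only on 𝒮 if it lies on one copy, only on s if it is of type (2,2), and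
  -- it never is for types (3,1) and (1,3).
  family₁ family₂ : List (SteinerSystem 3 4 (N + N))
  family₁ = zipWith shifted systems shifts
  family₂ = map twisted rows

  module _ (K : Subset (N + N)) where
    private
      Kˡ = take N K
      Kʳ = drop N K
      K? : (𝒮 : SteinerSystem 3 4 (N + N)) → _
      K? 𝒮 = block? 𝒮 K

    count₁-systems : ∀ K′ → ∣ K′ ∣ ≡ 4 → (∀ 𝒮 s → Block (shifted 𝒮 s) K ⇔ Block 𝒮 K′) →
                     count K? family₁ ≡ g * (2 + k)
    count₁-systems K′ ∣K′∣ B⇔ =
      trans (count-zipWithˡ K? shifted (λ 𝒮 → block? 𝒮 K′) B⇔ systems shifts length-shifts) (covering K′ ∣K′∣)

    count₁-none : (∀ 𝒮 s → ¬ Block (shifted 𝒮 s) K) → count K? family₁ ≡ 0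
    count₁-none ¬B = trans
      (count-zipWithˡ K? shifted none? (λ 𝒮 s → mk⇔ (¬B 𝒮 s) (λ ())) systems shifts length-shifts)
      (count-none none? (λ _ ()) systems)
      where
      none? : (𝒮 : SteinerSystem 3 4 N) → Dec Empty.⊥
      none? _ = no λ ()

    count₁-balanced : ∣ Kˡ ∣ ≡ 2 → ∣ Kʳ ∣ ≡ 2 → count K? family₁ ≡ k * g
    count₁-balanced ∣Kˡ∣ ∣Kʳ∣ = begin
      count K? family₁
        ≡⟨ count-zipWithʳ K? shifted (λ s → colour Kˡ ⊙ colour Kʳ ≟ suc s)
             (λ 𝒮 s → split-balanced (shifted-half s 𝒮) (shifted-half′ s 𝒮) ∣Kˡ∣ ∣Kʳ∣) systems shifts length-shifts ⟩
      count (λ s → colour Kˡ ⊙ colour Kʳ ≟ suc s) shifts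
        ≡⟨ count-repeat (λ s → colour Kˡ ⊙ colour Kʳ ≟ suc s) (k * g) (allFin (2 + k)) ⟩
      k * g * count (λ s → colour Kˡ ⊙ colour Kʳ ≟ suc s) (allFin (2 + k))
        -- The product of the two colours is not ∞ = `zero`, so it is `suc s` for exactly one s.
        ≡⟨ cong (k * g *_) (one-shift (colour Kˡ ⊙ colour Kʳ) (a⊙b≢∞ (colour≢∞ Kˡ ∣Kˡ∣))) ⟩
      k * g * 1
        ≡⟨ *-identityʳ (k * g) ⟩
      k * g
        ∎
      where
      one-shift : ∀ c → c ≢ zero → count (λ s → c ≟ suc s) (allFin (2 + k)) ≡ 1
      one-shift zero    c≢0 = contradiction refl c≢0
      one-shift (suc c) _   = count-≡1 (λ s → suc c ≟ suc s) c λ s → mk⇔ Fin.suc-injective (cong suc)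

    count₂-column : ∀ i d → (∀ r → Block (twisted r) K ⇔ matrix r i ≡ d) → count K? family₂ ≡ g * (2 + k)
    count₂-column i d B⇔ = trans (count-map K? twisted rows)
      (trans (count-cong (K? ∘ twisted) (λ r → matrix r i ≟ d) B⇔ rows) (column-balanced {g = g} PA i d))

    count₂-none : (∀ r → ¬ Block (twisted r) K) → count K? family₂ ≡ 0
    count₂-none ¬B = trans (count-map K? twisted rows) (count-none (K? ∘ twisted) ¬B rows)

    count₂-balanced : ∣ Kˡ ∣ ≡ 2 → ∣ Kʳ ∣ ≡ 2 → count K? family₂ ≡ 2 * g
    count₂-balanced ∣Kˡ∣ ∣Kʳ∣ = trans (count-map K? twisted rows) (trans
      (count-cong (K? ∘ twisted) (λ r → entries (matrix r) Kˡ ≟ˢ Kʳ)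
        (λ r → split-balanced (twisted-half r) (twisted-half′ r) ∣Kˡ∣ ∣Kʳ∣) rows)
      (balanced Kˡ ∣Kˡ∣ Kʳ ∣Kʳ∣))

    shifted-heavy : ∀ 𝒮 s → 3 ≤ ∣ Kˡ ∣ → Block (shifted 𝒮 s) K ⇔ Pure 𝒮 Kˡ Kʳ
    shifted-heavy 𝒮 s = split-heavy (shifted-half s 𝒮) (shifted-half′ s 𝒮) {Kˡ} {Kʳ}

    shifted-light : ∀ 𝒮 s → 3 ≤ ∣ Kʳ ∣ → Block (shifted 𝒮 s) K ⇔ Pure 𝒮 Kʳ Kˡ
    shifted-light 𝒮 s = split-light (shifted-half s 𝒮) (shifted-half′ s 𝒮) {Kˡ} {Kʳ}

    twisted-heavy : ∀ r → 3 ≤ ∣ Kˡ ∣ → Block (twisted r) K ⇔ Twisted 𝒮₀ (r ⁻¹) Kˡ Kʳ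
    twisted-heavy r = split-heavy (twisted-half r) (twisted-half′ r) {Kˡ} {Kʳ}

    twisted-light : ∀ r → 3 ≤ ∣ Kʳ ∣ → Block (twisted r) K ⇔ Twisted 𝒮₀ (matrix r) Kʳ Kˡ
    twisted-light r = split-light (twisted-half r) (twisted-half′ r) {Kˡ} {Kʳ}

    private
      4⇒3≤ : ∀ {a} → a ≡ 4 → 3 ≤ a
      4⇒3≤ refl = s≤s (s≤s (s≤s z≤n))

    -- Twisted blocks with at least three points on one copy have exactly one on the other, so only
    -- the large set contributes, through `covering`.
    count-4-0 : ∣ Kˡ ∣ ≡ 4 → ∣ Kʳ ∣ ≡ 0 → count K? family₁ + count K? family₂ ≡ g * (2 + k)
    count-4-0 ∣Kˡ∣ ∣Kʳ∣ = trans (cong₂ _+_ (count₁-systems Kˡ ∣Kˡ∣ pure) (count₂-none none)) (+-identityʳ _)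
      where
      pure : ∀ 𝒮 s → Block (shifted 𝒮 s) K ⇔ Block 𝒮 Kˡ
      pure 𝒮 s = mk⇔ (λ D → proj₁ (to (shifted-heavy 𝒮 s (4⇒3≤ ∣Kˡ∣)) D))
                     (λ B → from (shifted-heavy 𝒮 s (4⇒3≤ ∣Kˡ∣)) (B , ∣Kʳ∣))
      none : ∀ r → ¬ Block (twisted r) K
      none r D = case trans (sym ∣Kʳ∣) (proj₂ (to (twisted-heavy r (4⇒3≤ ∣Kˡ∣)) D)) of λ ()

    count-0-4 : ∣ Kˡ ∣ ≡ 0 → ∣ Kʳ ∣ ≡ 4 → count K? family₁ + count K? family₂ ≡ g * (2 + k)
    count-0-4 ∣Kˡ∣ ∣Kʳ∣ = trans (cong₂ _+_ (count₁-systems Kʳ ∣Kʳ∣ pure) (count₂-none none)) (+-identityʳ _)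
      where
      pure : ∀ 𝒮 s → Block (shifted 𝒮 s) K ⇔ Block 𝒮 Kʳ
      pure 𝒮 s = mk⇔ (λ D → proj₁ (to (shifted-light 𝒮 s (4⇒3≤ ∣Kʳ∣)) D))
                     (λ B → from (shifted-light 𝒮 s (4⇒3≤ ∣Kʳ∣)) (B , ∣Kˡ∣))
      none : ∀ r → ¬ Block (twisted r) K
      none r D = case trans (sym ∣Kˡ∣) (proj₂ (to (twisted-light r (4⇒3≤ ∣Kʳ∣)) D)) of λ ()

    -- With n = 3 + k, the two contributions g(n - 3) and 2g add up to g(n - 1).
    count-2-2 : ∣ Kˡ ∣ ≡ 2 → ∣ Kʳ ∣ ≡ 2 → count K? family₁ + count K? family₂ ≡ g * (2 + k)
    count-2-2 ∣Kˡ∣ ∣Kʳ∣ = trans (cong₂ _+_ (count₁-balanced ∣Kˡ∣ ∣Kʳ∣) (count₂-balanced ∣Kˡ∣ ∣Kʳ∣)) (collect k g)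
      where
      collect : ∀ k g → k * g + 2 * g ≡ g * (2 + k)
      collect = solve-∀

    -- Let w complete `Kˡ` to a block of 𝒮₀ and let d be the point of `Kʳ`. Row π contributes
    -- exactly when π(w) = d, that is, when column w shows d.
    count-3-1 : ∣ Kˡ ∣ ≡ 3 → ∣ Kʳ ∣ ≡ 1 → count K? family₁ + count K? family₂ ≡ g * (2 + k)
    count-3-1 ∣Kˡ∣ ∣Kʳ∣ = cong₂ _+_ (count₁-none none)
      (let w , B⇔ = extension-point 𝒮₀ Kˡ ∣Kˡ∣
           d , Kʳ≡d = ∣p∣≡1⇒singleton Kʳ ∣Kʳ∣
       in count₂-column w d (column B⇔ Kʳ≡d))
      where
      3≤ : 3 ≤ ∣ Kˡ ∣
      3≤ = ≤-reflexive (sym ∣Kˡ∣)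
      none : ∀ 𝒮 s → ¬ Block (shifted 𝒮 s) K
      none 𝒮 s D = case trans (sym ∣Kʳ∣) (proj₂ (to (shifted-heavy 𝒮 s 3≤) D)) of λ ()
      module _ {w d} (B⇔ : ∀ x → Block 𝒮₀ (Kˡ ∪ ⁅ x ⁆) ⇔ w ≡ x) (Kʳ≡d : Kʳ ≡ ⁅ d ⁆) where
        image : ∀ r → entries (r ⁻¹) Kʳ ≡ ⁅ (r ⁻¹) d ⁆
        image r = trans (cong (entries (r ⁻¹)) Kʳ≡d) (entries-singleton (r ⁻¹) d)
        ⇒ : ∀ r → Twisted 𝒮₀ (r ⁻¹) Kˡ Kʳ → matrix r w ≡ d
        ⇒ r ((_ , B) , _) =
          trans (cong (matrix r) (to (B⇔ ((r ⁻¹) d)) (subst (λ U → Block 𝒮₀ (Kˡ ∪ U)) (image r) B))) (inverseʳ r d)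
        ⇐ : ∀ r → matrix r w ≡ d → Twisted 𝒮₀ (r ⁻¹) Kˡ Kʳ
        ⇐ r eq = (∣Kˡ∣ , subst (λ U → Block 𝒮₀ (Kˡ ∪ U)) (sym (image r))
          (from (B⇔ ((r ⁻¹) d)) (trans (sym (inverseˡ r w)) (cong (r ⁻¹) eq)))) , ∣Kʳ∣
        column : ∀ r → Block (twisted r) K ⇔ matrix r w ≡ d
        column r = mk⇔ (λ D → ⇒ r (to (twisted-heavy r 3≤) D)) (λ eq → from (twisted-heavy r 3≤) (⇐ r eq))

    -- Now c is the point of `Kˡ` and w completes `Kʳ`; row π contributes exactly when column c
    -- shows w.
    count-1-3 : ∣ Kˡ ∣ ≡ 1 → ∣ Kʳ ∣ ≡ 3 → count K? family₁ + count K? family₂ ≡ g * (2 + k)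
    count-1-3 ∣Kˡ∣ ∣Kʳ∣ = cong₂ _+_ (count₁-none none)
      (let w , B⇔ = extension-point 𝒮₀ Kʳ ∣Kʳ∣
           c , Kˡ≡c = ∣p∣≡1⇒singleton Kˡ ∣Kˡ∣
       in count₂-column c w (column B⇔ Kˡ≡c))
      where
      3≤ : 3 ≤ ∣ Kʳ ∣
      3≤ = ≤-reflexive (sym ∣Kʳ∣)
      none : ∀ 𝒮 s → ¬ Block (shifted 𝒮 s) K
      none 𝒮 s D = case trans (sym ∣Kˡ∣) (proj₂ (to (shifted-light 𝒮 s 3≤) D)) of λ ()
      module _ {c w} (B⇔ : ∀ x → Block 𝒮₀ (Kʳ ∪ ⁅ x ⁆) ⇔ w ≡ x) (Kˡ≡c : Kˡ ≡ ⁅ c ⁆) where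
        image : ∀ r → entries (matrix r) Kˡ ≡ ⁅ matrix r c ⁆
        image r = trans (cong (entries (matrix r)) Kˡ≡c) (entries-singleton (matrix r) c)
        ⇒ : ∀ r → Twisted 𝒮₀ (matrix r) Kʳ Kˡ → matrix r c ≡ w
        ⇒ r ((_ , B) , _) = sym (to (B⇔ (matrix r c)) (subst (λ U → Block 𝒮₀ (Kʳ ∪ U)) (image r) B))
        ⇐ : ∀ r → matrix r c ≡ w → Twisted 𝒮₀ (matrix r) Kʳ Kˡ
        ⇐ r eq = (∣Kʳ∣ , subst (λ U → Block 𝒮₀ (Kʳ ∪ U)) (sym (image r)) (from (B⇔ (matrix r c)) (sym eq))) , ∣Kˡ∣
        column : ∀ r → Block (twisted r) K ⇔ matrix r c ≡ w
        column r = mk⇔ (λ D → ⇒ r (to (twisted-light r 3≤) D)) (λ eq → from (twisted-light r 3≤) (⇐ r eq))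

    count-total : ∣ Kˡ ∣ + ∣ Kʳ ∣ ≡ 4 → count K? family₁ + count K? family₂ ≡ g * (2 + k)
    count-total sum = by-size (sum≡4 sum)
      where
      by-size : _ → _
      by-size (inj₁ (∣Kˡ∣ , ∣Kʳ∣))                      = count-4-0 ∣Kˡ∣ ∣Kʳ∣
      by-size (inj₂ (inj₁ (∣Kˡ∣ , ∣Kʳ∣)))               = count-3-1 ∣Kˡ∣ ∣Kʳ∣
      by-size (inj₂ (inj₂ (inj₁ (∣Kˡ∣ , ∣Kʳ∣))))        = count-2-2 ∣Kˡ∣ ∣Kʳ∣
      by-size (inj₂ (inj₂ (inj₂ (inj₁ (∣Kˡ∣ , ∣Kʳ∣))))) = count-1-3 ∣Kˡ∣ ∣Kʳ∣
      by-size (inj₂ (inj₂ (inj₂ (inj₂ (∣Kˡ∣ , ∣Kʳ∣))))) = count-0-4 ∣Kˡ∣ ∣Kʳ∣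

  family₁≢[] : family₁ ≢ []
  family₁≢[] eq = zip-nonempty systems shifts length-shifts nonempty eq
    where
    zip-nonempty : ∀ xs ys → length xs ≡ length ys → xs ≢ [] → zipWith shifted xs ys ≢ []
    zip-nonempty []       _        _ xs≢[] _ = xs≢[] refl
    zip-nonempty (x ∷ xs) (y ∷ ys) _ _     ()

  largeSet : LargeSet 3 4 (N + N) (g * (2 + k))
  largeSet = record
    { systems  = family₁ ++ˡ family₂
    ; nonempty = family₁≢[] ∘ ++-conicalˡ family₁ family₂
    ; covering = λ K ∣K∣ → trans (count-++ (λ 𝒮 → block? 𝒮 K) family₁ family₂)
                                 (count-total K (trans (∣take∣+∣drop∣ N K) ∣K∣))
    }

theorem27 : ∀ (n g : ℕ) → 0 < n → 0 < g →
    PerpendicularArray (2 * g) 2 n n →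
    LargeSet 3 4 n (g * (n ∸ 1)) →
    LargeSet 3 4 (2 * n) (g * (n ∸ 1))
-- Two points have neither 3-subsets nor 4-subsets, so one copy of the trivial system suffices.
theorem27 1 g _ _ _ _ = trivialLargeSet 1 (λ ())
  (λ T ∣T∣ → contradiction (subst (_≤ 2) ∣T∣ (∣p∣≤n T)) λ { (s≤s (s≤s ())) })
  (λ K ∣K∣ → contradiction (subst (_≤ 2) ∣K∣ (∣p∣≤n K)) λ { (s≤s (s≤s ())) })
-- The four points form the only block, needed g(2 - 1) = g times; 0 < g makes the list nonempty.
theorem27 2 g _ 0<g _ _ = trivialLargeSet g (λ { refl → case 0<g of λ () }) (λ _ _ → refl)
  (λ _ _ → sym (*-identityʳ g))
-- The first system of the nonempty large set serves as 𝒮₀. The transport is needed because `2 * n`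
-- computes to `n + (n + 0)`.
theorem27 n@(suc (suc (suc k))) g _ _ PA L with LargeSet.systems L in eq
... | []     = contradiction eq (LargeSet.nonempty L)
... | 𝒮₀ ∷ _ = subst (λ m → LargeSet 3 4 (n + m) (g * (n ∸ 1))) (sym (+-identityʳ n))
                 (Doubling.largeSet {g = g} PA L 𝒮₀)
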